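{- For every odd prime power $q$ there exists at least one special spread in $\mathrm{PG}(3,q)$ (with respect to a given symplectic polarity of $\mathrm{PG}(3,q)$).
   Context: A symplectic polarity $\zeta$ of $\mathrm{PG}(3,q)$ is a polarity with $x\in x^\zeta$ for every point $x$. Two points $x,y$ are orthogonal if $y\in x^\zeta$. A line $L$ is totally isotropic if $L^\zeta=L$. A spread is a set of lines of $\mathrm{PG}(3,q)$ partitioning its point set. For $q$ odd, a special spread (with respect to a given symplectic polarity $\zeta$) is a spread $S$ consisting of lines that are not totally isotropic such that for every $\ell\in S$ there is a uniquely determined line $\ell'\in S$ such that any point of $\ell$ is orthogonal to any point of $\ell'$ (that is, $\ell'=\ell^\zeta$). -}

module Defs where

open import Algebra.Apartness.Bundles using (HeytingCommutativeRing; HeytingField)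
open import Algebra.Bundles using (CommutativeRing)
import Algebra.Properties.Semiring.Sum as Sum
open import Data.Fin.Base using (Fin)
open import Data.Fin.Properties using (≡-setoid)
open import Data.Nat.Base using (ℕ; suc; _^_)
open import Data.Nat.Primality using (Prime)
open import Data.Product using (_×_; ∃; ∃-syntax; ∃₂; ∃!)
open import Data.Vec.Functional using (Vector; zipWith; map; replicate)
import Data.Vec.Functional.Relation.Binary.Equality.Setoid as VecEq
open import Function.Bundles using (Inverse)
open import Level using (_⊔_) renaming (suc to lsuc)
open import Relation.Binary.Definitions using (_Respects_)
open import Relation.Binary.PropositionalEquality using (_≡_)
open import Relation.Nullary using (¬_)
open import Relation.Unary as U using (Pred; Decidable; _∈_)

IsPrimePower : ℕ → Set
IsPrimePower q = ∃₂ λ p k → Prime p × q ≡ p ^ suc k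

-- A finite field has decidable equality, so for finite fields `HeytingField` is
-- just the classical notion of a field: `#` coincides with `≉`, and nontriviality
-- follows from irreflexivity of `#`.

HasOrder : ∀ {c ℓ₁ ℓ₂} → HeytingField c ℓ₁ ℓ₂ → ℕ → Set (c ⊔ ℓ₁)
HasOrder F q = Inverse (HeytingField.setoid F) (≡-setoid q)

module PG {c ℓ₁ ℓ₂} (F : HeytingField c ℓ₁ ℓ₂) (d : ℕ) where

  open HeytingField F using (Carrier; _≈_; _+_; _*_; 0#; setoid)
  open HeytingCommutativeRing (HeytingField.heytingCommutativeRing F)
    using (commutativeRing)
  open CommutativeRing commutativeRing using (semiring)
  open Sum semiring using (sum)
  open VecEq setoid using (_≋_)

  V : Set c
  V = Vector Carrier (suc d)

  linComb : ∀ {k} → Vector Carrier k → Vector V k → V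
  linComb a b j = sum (λ i → a i * b i j)

  -- Membership is required to be decidable, as it is classically.  For finite
  -- `F` nothing is lost: every span of finitely many vectors is decidable.

  record Subspace : Set (lsuc (c ⊔ ℓ₁)) where
    field
      Member   : Pred V (c ⊔ ℓ₁)
      member?  : Decidable Member
      resp     : Member Respects _≋_
      0-closed : replicate _ 0# ∈ Member
      +-closed : ∀ {u v} → u ∈ Member → v ∈ Member → zipWith _+_ u v ∈ Member
      *-closed : ∀ a {v} → v ∈ Member → map (a *_) v ∈ Member

  open Subspace public using (Member)

  infix 4 _⊆_ _≐_

  _⊆_ : Subspace → Subspace → Set (c ⊔ ℓ₁)
  U ⊆ W = Member U U.⊆ Member W

  _≐_ : Subspace → Subspace → Set (c ⊔ ℓ₁)
  U ≐ W = Member U U.≐ Member W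

  record IsBasis (U : Subspace) {k} (b : Vector V k) : Set (c ⊔ ℓ₁) where
    field
      members     : ∀ i → b i ∈ Member U
      independent : ∀ a → linComb a b ≋ replicate _ 0# → ∀ i → a i ≈ 0#
      spanning    : ∀ {v} → v ∈ Member U → ∃[ a ] v ≋ linComb a b

  HasRank : Subspace → ℕ → Set (c ⊔ ℓ₁)
  HasRank U k = ∃ λ (b : Vector V k) → IsBasis U b

  -- Projective dimension is vector space dimension minus one.

  record Point : Set (lsuc (c ⊔ ℓ₁)) where
    field
      space : Subspace
      rank  : HasRank space 1

  record Line : Set (lsuc (c ⊔ ℓ₁)) where
    field
      space : Subspace
      rank  : HasRank space 2

  infix 4 _on_ _≐ᴸ_

  _on_ : Point → Line → Set (c ⊔ ℓ₁)
  x on L = Point.space x ⊆ Line.space L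

  _≐ᴸ_ : Line → Line → Set (c ⊔ ℓ₁)
  L ≐ᴸ M = Line.space L ≐ Line.space M

  -- An inclusion-reversing involution of the lattice of subspaces.
  -- It preserves `_≐_` by `antitone`, and is a bijection by `involutive`.

  record Polarity : Set (lsuc (c ⊔ ℓ₁)) where
    field
      _^ζ        : Subspace → Subspace
      antitone   : ∀ {U W} → U ⊆ W → W ^ζ ⊆ U ^ζ
      involutive : ∀ U → (U ^ζ) ^ζ ≐ U

  record SymplecticPolarity : Set (lsuc (c ⊔ ℓ₁)) where
    field
      polarity : Polarity
    open Polarity polarity public
    field
      absolute : ∀ x → Point.space x ⊆ Point.space x ^ζ

  record IsSpread (S : Pred Line (c ⊔ ℓ₁)) : Set (lsuc (c ⊔ ℓ₁)) where
    field
      resp       : S Respects _≐ᴸ_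
      partitions : ∀ x → ∃! _≐ᴸ_ λ L → L ∈ S × x on L

  module _ (ζ : SymplecticPolarity) where
    open SymplecticPolarity ζ

    Orthogonal : Point → Point → Set (c ⊔ ℓ₁)
    Orthogonal x y = Point.space y ⊆ Point.space x ^ζ

    TotallyIsotropic : Line → Set (c ⊔ ℓ₁)
    TotallyIsotropic L = Line.space L ^ζ ≐ Line.space L

    OrthogonalLines : Line → Line → Set (lsuc (c ⊔ ℓ₁))
    OrthogonalLines L M = ∀ x y → x on L → y on M → Orthogonal x y

    record IsSpecialSpread (S : Pred Line (c ⊔ ℓ₁)) : Set (lsuc (c ⊔ ℓ₁)) where
      field
        isSpread     : IsSpread S
        nonIsotropic : ∀ {L} → L ∈ S → ¬ TotallyIsotropic L
        partner      : ∀ {L} → L ∈ S → ∃! _≐ᴸ_ λ M → M ∈ S × OrthogonalLines L M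

{-# OPTIONS --safe #-}

-- For vectors x, y write x ⊥ y if y lies in the polar hyperplane of ⟨ x ⟩.  Every vector being
-- orthogonal to itself forces ⊥ to come, in suitable coordinates v = (a , b , c , d), from the form
-- x₀y₁ − x₁y₀ − x₂y₃ + x₃y₂; no appeal to the fundamental theorem of projective geometry is needed.
--
-- For a nonsquare ν put K = F(√ν), X = a + b√ν, Y = c + d√ν and Q(v) = N(X) − N(Y).  Multiplication
-- by √ν on (X , Y) and on (X̄ , Y) gives two maps J with J² = ν.  Both multiply Q along the lines
-- ⟨ v , J v ⟩ by nonzero norms, so that taking the first J where Q(v) ≠ 0 and the second where Q(v) = 0
-- gives a spread: the regular spread of K² with the regulus Q = 0 replaced by its opposite.  The polar
-- of the line of (X , Y) is the line of (Ȳ , X̄) if Q(v) ≠ 0, and that of (−X , Y) if Q(v) = 0.  As q is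
-- odd, the form does not vanish on any line of the spread.

module Submission where

open import Defs
open import Algebra.Apartness.Bundles using (HeytingCommutativeRing; HeytingField)
open import Algebra.Bundles using (CommutativeRing)
import Algebra.Properties.CommutativeMonoid.Sum as CommutativeMonoidSum
import Algebra.Properties.Ring as RingProperties
import Algebra.Properties.Semiring.Sum as SemiringSum
open import Data.Fin.Base as Fin using (Fin; zero; suc; combine; funToFin; finToFun)
open import Data.Fin.Patterns using (0F; 1F; 2F; 3F)
import Data.Fin.Permutation as Perm
import Data.Fin.Properties as Finₚ
import Data.Integer.Properties as ℤₚ
open import Data.Maybe.Base using (Maybe; just; nothing)
open import Data.Nat.Base as ℕ using (ℕ; zero; suc)
open import Data.Nat.Divisibility using (_∣_; _∤_; divides)
import Data.Nat.Properties as ℕₚ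
open import Data.Product using (∃; ∃₂; ∃!; ∃-syntax; _×_; _,_; proj₁; proj₂)
open import Data.Unit.Base using (⊤)
open import Data.Vec.Functional using (Vector; replicate; zipWith; map; []; _∷_)
import Data.Vec.Functional.Relation.Binary.Equality.Setoid as VecEq
open import Function.Base using (_∘_; _$_; id)
open import Function.Bundles using (Inverse)
open import Level using (_⊔_; Lift)
open import Relation.Binary.Bundles using (Setoid)
open import Relation.Binary.Core using (Rel)
open import Relation.Binary.Definitions using (_Respects_; Reflexive; Symmetric; tri<; tri≈; tri>)
  renaming (Decidable to Decidable₂)
open import Relation.Binary.PropositionalEquality as ≡ using (_≡_; _≗_)
open import Relation.Nullary using (¬_; Dec; yes; no; contradiction)
open import Relation.Nullary.Decidable as Dec using (¬?; decidable-stable)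
open import Relation.Unary using (Pred; Decidable)
open import Relation.Unary.Properties using (≐-sym; ≐-trans)

-- A polarity supplies, for each u, only some scalar r(u) with e₁ + u f₂ ⊥ e₂ + r(u) f₁, and for
-- each t some s(t) with e₁ + t e₂ ⊥ f₂ + s(t) f₁. For a Hermitian polarity such functions would
-- involve a field automorphism. Here e₁ + t e₂ + u f₂ is orthogonal to itself, which gives t r(u) +
-- u s(t) = 0, and the normalisation s(1) = 1 then forces r(u) = -u and s(t) = t.
--
-- The regulus has to be exchanged because the form takes the value Q(v) on v and √ν v: the regular
-- spread has totally isotropic lines exactly where Q = 0. There the second map gives -(N(X) + N(Y))
-- = -2 N(Y), which is nonzero for v ≠ 0. Used everywhere, the second map would fail in turn where
-- N(X) + N(Y) = 0.
--
-- Classical arguments by contradiction are available because existence over a finite field is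
-- decided by exhaustive search.

-- Ring solver with integer coefficients.

module IntegerCoefficients {c ℓ} (R : CommutativeRing c ℓ) where

  open CommutativeRing R hiding (zero)
  open RingProperties ring
  open import Algebra.Properties.Semiring.Mult.TCOptimised semiring renaming (_×_ to infixl 8 _·_)
  open import Algebra.Solver.Ring.AlmostCommutativeRing
  open import Data.Integer.Base as ℤ using (ℤ; +_; -[1+_])
  open import Relation.Binary.Reasoning.Setoid setoid

  -- With the optimised multiples `1 · 1#` reduces to `1#`, so the literal `:1` denotes `1#` by
  -- computation.
  fromℤ : ℤ → Carrier
  fromℤ (+ n)    = n · 1#
  fromℤ -[1+ n ] = - (suc n · 1#)

  private
    add-both : ∀ a x y → (a + x) - (a + y) ≈ x - y
    add-both a x y = begin
      (a + x) - (a + y)      ≈⟨ +-congˡ (-‿+-comm a y) ⟨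
      (a + x) + (- a - y)    ≈⟨ +-congʳ (+-comm a x) ⟩
      (x + a) + (- a - y)    ≈⟨ +-assoc x a (- a - y) ⟩
      x + (a + (- a - y))    ≈⟨ +-congˡ (+-assoc a (- a) (- y)) ⟨
      x + ((a - a) - y)      ≈⟨ +-congˡ (+-congʳ (-‿inverseʳ a)) ⟩
      x + (0# - y)           ≈⟨ +-congˡ (+-identityˡ (- y)) ⟩
      x - y                  ∎

  fromℤ-⊖ : ∀ m n → fromℤ (m ℤ.⊖ n) ≈ m · 1# - n · 1#
  fromℤ-⊖ zero    zero    = sym (-‿inverseʳ 0#)
  fromℤ-⊖ zero    (suc n) = sym (+-identityˡ _)
  fromℤ-⊖ (suc m) zero    = begin
    suc m · 1#       ≈⟨ +-identityʳ _ ⟨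
    suc m · 1# + 0#  ≈⟨ +-congˡ -0#≈0# ⟨
    suc m · 1# - 0#  ∎
  fromℤ-⊖ (suc m) (suc n) = begin
    fromℤ (suc m ℤ.⊖ suc n)            ≡⟨ ≡.cong fromℤ (ℤₚ.[1+m]⊖[1+n]≡m⊖n m n) ⟩
    fromℤ (m ℤ.⊖ n)                    ≈⟨ fromℤ-⊖ m n ⟩
    m · 1# - n · 1#                    ≈⟨ add-both 1# (m · 1#) (n · 1#) ⟨
    (1# + m · 1#) - (1# + n · 1#)      ≈⟨ +-cong (1+× m 1#) (-‿cong (1+× n 1#)) ⟨
    suc m · 1# - suc n · 1#            ∎

  fromℤ-+ : ∀ i j → fromℤ (i ℤ.+ j) ≈ fromℤ i + fromℤ j
  fromℤ-+ (+ m)    (+ n)    = ×-homo-+ 1# m n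
  fromℤ-+ (+ m)    -[1+ n ] = fromℤ-⊖ m (suc n)
  fromℤ-+ -[1+ m ] (+ n)    = trans (fromℤ-⊖ n (suc m)) (+-comm _ _)
  fromℤ-+ -[1+ m ] -[1+ n ] = begin
    - (suc (suc (m ℕ.+ n)) · 1#)        ≡⟨ ≡.cong (λ k → - (suc k · 1#)) (ℕₚ.+-suc m n) ⟨
    - ((suc m ℕ.+ suc n) · 1#)          ≈⟨ -‿cong (×-homo-+ 1# (suc m) (suc n)) ⟩
    - (suc m · 1# + suc n · 1#)         ≈⟨ -‿+-comm _ _ ⟨
    - (suc m · 1#) - suc n · 1#         ∎

  fromℤ-neg : ∀ i → fromℤ (ℤ.- i) ≈ - fromℤ i
  fromℤ-neg (+ zero)  = sym -0#≈0#
  fromℤ-neg (+ suc n) = refl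
  fromℤ-neg -[1+ n ]  = sym (-‿involutive _)

  private
    fromℤ-*-pos : ∀ i n → fromℤ (i ℤ.* + n) ≈ fromℤ i * fromℤ (+ n)
    fromℤ-*-pos (+ m) n = begin
      fromℤ (+ m ℤ.* + n)  ≡⟨ ≡.cong fromℤ (ℤₚ.pos-* m n) ⟨
      (m ℕ.* n) · 1#       ≈⟨ ×1-homo-* m n ⟩
      (m · 1#) * (n · 1#)  ∎
    fromℤ-*-pos -[1+ m ] n = begin
      fromℤ (-[1+ m ] ℤ.* + n)         ≡⟨ ≡.cong fromℤ (ℤₚ.neg-distribˡ-* (+ suc m) (+ n)) ⟨
      fromℤ (ℤ.- (+ suc m ℤ.* + n))    ≈⟨ fromℤ-neg (+ suc m ℤ.* + n) ⟩
      - fromℤ (+ suc m ℤ.* + n)        ≈⟨ -‿cong (fromℤ-*-pos (+ suc m) n) ⟩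
      - ((suc m · 1#) * (n · 1#))      ≈⟨ -‿distribˡ-* _ _ ⟩
      - (suc m · 1#) * (n · 1#)        ∎

  fromℤ-* : ∀ i j → fromℤ (i ℤ.* j) ≈ fromℤ i * fromℤ j
  fromℤ-* i (+ n)      = fromℤ-*-pos i n
  fromℤ-* i j@(-[1+ n ]) = begin
    fromℤ (i ℤ.* j)                ≡⟨ ≡.cong fromℤ (ℤₚ.neg-distribʳ-* i (+ suc n)) ⟨
    fromℤ (ℤ.- (i ℤ.* + suc n))    ≈⟨ fromℤ-neg (i ℤ.* + suc n) ⟩
    - fromℤ (i ℤ.* + suc n)        ≈⟨ -‿cong (fromℤ-*-pos i (suc n)) ⟩
    - (fromℤ i * (suc n · 1#))     ≈⟨ -‿distribʳ-* _ _ ⟩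
    fromℤ i * - (suc n · 1#)       ∎

  private
    coeff≟ : ∀ i j → Maybe (fromℤ i ≈ fromℤ j)
    coeff≟ i j with i ℤₚ.≟ j
    ... | yes ≡.refl = just refl
    ... | no _       = nothing

  fromℤ-morphism : ℤ.+-*-rawRing -Raw-AlmostCommutative⟶ fromCommutativeRing R
  fromℤ-morphism = record
    { ⟦_⟧ = fromℤ ; +-homo = fromℤ-+ ; *-homo = fromℤ-* ; -‿homo = fromℤ-neg ; 0-homo = refl ; 1-homo = refl }

  -- Coefficients in ℤ rather than in R make cancellation decidable for the solver.
  open import Algebra.Solver.Ring ℤ.+-*-rawRing (fromCommutativeRing R) fromℤ-morphism coeff≟ public
    using (Polynomial; solve; _:=_; _:+_; _:*_; :-_; _:-_; con)

  :0 :1 : ∀ {n} → Polynomial n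
  :0 = con (+ 0)
  :1 = con (+ 1)

-- Counting and searching in finite sets.

-- Of each pair `i`, `f i` exactly one is sent to a smaller element, so the descents at `i` and at
-- `f i` add up to 1. Summing over all `i` and reindexing by `f` counts every descent twice.
fixedPointFree-involution⇒even :
  ∀ {n} (f : Fin n → Fin n) → (∀ i → f (f i) ≡ i) → (∀ i → ¬ f i ≡ i) → 2 ∣ n
fixedPointFree-involution⇒even {n} f f-inv f-free = divides (sum descents) $ begin
  n                                         ≡⟨ ones n ⟨
  sum {n} (λ _ → 1)                         ≡⟨ sum-cong-≗ (λ i → one (f i Finₚ.<? i) (f (f i) Finₚ.<? f i)) ⟨
  sum (λ i → descents i ℕ.+ descents (f i)) ≡⟨ ∑-distrib-+ descents (descents ∘ f) ⟩
  sum descents ℕ.+ sum (descents ∘ f)       ≡⟨ ≡.cong (sum descents ℕ.+_) (sum-permute descents π) ⟨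
  sum descents ℕ.+ sum descents             ≡⟨ ≡.cong (sum descents ℕ.+_) (ℕₚ.+-identityʳ _) ⟨
  2 ℕ.* sum descents                        ≡⟨ ℕₚ.*-comm 2 (sum descents) ⟩
  sum descents ℕ.* 2                        ∎
  where
  open CommutativeMonoidSum ℕₚ.+-0-commutativeMonoid
  open ≡.≡-Reasoning

  indicator : ∀ {P : Set} → Dec P → ℕ
  indicator (yes _) = 1
  indicator (no _)  = 0

  descents : Fin n → ℕ
  descents i = indicator (f i Finₚ.<? i)

  one : ∀ {i} (p : Dec (f i Fin.< i)) (p′ : Dec (f (f i) Fin.< f i)) → indicator p ℕ.+ indicator p′ ≡ 1
  one {i} p p′ rewrite f-inv i with p | p′ | Finₚ.<-cmp (f i) i
  ... | _ | _ | tri≈ _ fi≡i _ = contradiction fi≡i (f-free i)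
  ... | yes _ | yes b | tri< _ _ ¬b = contradiction b ¬b
  ... | yes _ | no _ | tri< _ _ _ = ≡.refl
  ... | no ¬a | _ | tri< a _ _ = contradiction a ¬a
  ... | yes a | _ | tri> ¬a _ _ = contradiction a ¬a
  ... | no _ | yes _ | tri> _ _ _ = ≡.refl
  ... | no _ | no ¬b | tri> _ _ b = contradiction b ¬b

  π : Perm.Permutation n n
  π = Perm.permutation f f f-inv f-inv

  ones : ∀ m → sum {m} (λ _ → 1) ≡ m
  ones zero    = ≡.refl
  ones (suc m) = ≡.cong suc (ones m)

module FiniteSetoid {a ℓ} (S : Setoid a ℓ) {n} (enumeration : Inverse S (Finₚ.≡-setoid n)) where

  open Setoid S
  open Inverse enumeration using (to; from; to-cong; strictlyInverseʳ)

  to-injective : ∀ {x y} → to x ≡ to y → x ≈ y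
  to-injective {x} {y} eq = trans (sym (strictlyInverseʳ x))
    (trans (reflexive (≡.cong from eq)) (strictlyInverseʳ y))

  _≟_ : Decidable₂ _≈_
  x ≟ y = Dec.map′ to-injective to-cong (to x Finₚ.≟ to y)

  -- Only the representatives `from i` are tested; `resp` moves a witness to its representative.
  -- Together with `decidable-stable` this later turns a refuted non-existence into a witness.
  search : ∀ {p} {P : Pred Carrier p} → P Respects _≈_ → Decidable P → Dec (∃ P)
  search resp P? = Dec.map′ (λ (i , p) → from i , p)
    (λ (x , p) → to x , resp (sym (strictlyInverseʳ x)) p) (Finₚ.any? (P? ∘ from))

  decide-∀ : ∀ {p} {P : Pred Carrier p} → P Respects _≈_ → Decidable P → Dec (∀ x → P x)
  decide-∀ resp P? = Dec.map′ (λ h x → resp (strictlyInverseʳ x) (h (to x)))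
    (λ h i → h (from i)) (Finₚ.all? (P? ∘ from))

module _ {a ℓ} (S : Setoid a ℓ) {q} (enumeration : Inverse S (Finₚ.≡-setoid q)) where

  open Setoid S
  open VecEq S
  open Inverse enumeration

  funToFin-cong : ∀ {m n} {f g : Fin m → Fin n} → f ≗ g → funToFin f ≡ funToFin g
  funToFin-cong {zero}  f≗g = ≡.refl
  funToFin-cong {suc m} f≗g = ≡.cong₂ combine (f≗g zero) (funToFin-cong (f≗g ∘ suc))

  vectorEnumeration : ∀ m → Inverse (≋-setoid m) (Finₚ.≡-setoid (q ℕ.^ m))
  vectorEnumeration m = record
    { to        = λ v → funToFin (to ∘ v)
    ; from      = λ k → from ∘ finToFun k
    ; to-cong   = λ v≋w → funToFin-cong (to-cong ∘ v≋w)
    ; from-cong = λ { ≡.refl → ≋-refl }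
    ; inverse   =
        (λ {k} {v} v≋ → ≡.trans (funToFin-cong (λ i → inverseˡ (v≋ i))) (Finₚ.funToFin-finToFin {m} k))
      , (λ {v} → λ { ≡.refl i → inverseʳ (Finₚ.finToFun-funToFin (to ∘ v) i) })
    }

-- Linear algebra over a finite field.

module FiniteField {c ℓ₁ ℓ₂} (F : HeytingField c ℓ₁ ℓ₂) {q} (order : HasOrder F q) where

  open HeytingField F using (tight; #-irrefl; #⇒invertible; invertible⇒#)

  commutativeRing : CommutativeRing c ℓ₁
  commutativeRing = HeytingCommutativeRing.commutativeRing (HeytingField.heytingCommutativeRing F)

  open CommutativeRing commutativeRing public hiding (zero)
  open RingProperties ring public using (-0#≈0#; -‿involutive)
  open IntegerCoefficients commutativeRing public using (Polynomial; solve; _:=_; _:+_; _:*_; :-_; _:-_; :0; :1)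
  open SemiringSum semiring public using (sum; ∑-distrib-+; *-distribˡ-sum; sum-cong-≋)
  open VecEq setoid public
  open FiniteSetoid setoid order public
  open import Relation.Binary.Reasoning.Setoid setoid

  1≉0 : ¬ 1# ≈ 0#
  1≉0 1≈0 = #-irrefl 1≈0 (invertible⇒# (1# , trans (*-identityˡ _) 1-0 , trans (*-identityʳ _) 1-0))
    where
    1-0 : 1# - 0# ≈ 1#
    1-0 = solve 0 (:1 :- :0 := :1) refl

  abstract
    -- The field axioms invert only what is apart from zero, and by tightness `¬ x ≈ 0#` yields
    -- apartness merely up to double negation. Searching the field for the inverse removes the
    -- double negation.
    reciprocal : ∀ {x} → ¬ x ≈ 0# → ∃[ y ] y * x ≈ 1#
    reciprocal {x} x≉0 = decidable-stable
      (search (λ y≈z → trans (*-congʳ (sym y≈z))) (λ y → (y * x) ≟ 1#))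
      λ none → x≉0 $ proj₁ (tight x 0#) λ x#0 → none $
        let y , y[x-0]≈1 , _ = #⇒invertible x#0 in
        y , trans (*-congˡ (solve 1 (λ x → x := x :- :0) refl x)) y[x-0]≈1

  *-cancelˡ-0 : ∀ {x y} → ¬ x ≈ 0# → x * y ≈ 0# → y ≈ 0#
  *-cancelˡ-0 {x} {y} x≉0 xy≈0 = let z , zx≈1 = reciprocal x≉0 in begin
    y            ≈⟨ *-identityˡ y ⟨
    1# * y       ≈⟨ *-congʳ zx≈1 ⟨
    (z * x) * y  ≈⟨ *-assoc z x y ⟩
    z * (x * y)  ≈⟨ *-congˡ xy≈0 ⟩
    z * 0#       ≈⟨ zeroʳ z ⟩
    0#           ∎

  x*x≈0⇒x≈0 : ∀ {x} → x * x ≈ 0# → x ≈ 0#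
  x*x≈0⇒x≈0 {x} x²≈0 = decidable-stable (x ≟ 0#) λ x≉0 → x≉0 (*-cancelˡ-0 x≉0 x²≈0)

  x-y≈0⇒x≈y : ∀ {x y} → x - y ≈ 0# → x ≈ y
  x-y≈0⇒x≈y {x} {y} x-y≈0 = begin
    x            ≈⟨ solve 2 (λ x y → x := (x :- y) :+ y) refl x y ⟩
    (x - y) + y  ≈⟨ +-congʳ x-y≈0 ⟩
    0# + y       ≈⟨ +-identityˡ y ⟩
    y            ∎

  1<q : 1 ℕ.< q
  1<q = Finₚ.injective⇒≤ {f = f} f-injective
    where
    open Inverse order using (to)
    f : Fin 2 → Fin q
    f zero    = to 0#
    f (suc _) = to 1#
    f-injective : ∀ {i j} → f i ≡ f j → i ≡ j
    f-injective {zero}     {zero}     _  = ≡.refl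
    f-injective {zero}     {suc zero} eq = contradiction (sym (to-injective eq)) 1≉0
    f-injective {suc zero} {zero}     eq = contradiction (to-injective eq) 1≉0
    f-injective {suc zero} {suc zero} _  = ≡.refl

  0ᵛ : ∀ {n} → Vector Carrier n
  0ᵛ = replicate _ 0#

  module _ {n : ℕ} where
    private module Vectors = FiniteSetoid (≋-setoid n) (vectorEnumeration setoid order n)
    open Vectors public using () renaming (_≟_ to _≟ᵛ_; search to searchᵛ)

  infixl 6 _+ᵛ_
  infixr 7 _*ᵛ_

  _+ᵛ_ : ∀ {n} → Vector Carrier n → Vector Carrier n → Vector Carrier n
  _+ᵛ_ = zipWith _+_

  _*ᵛ_ : ∀ {n} → Carrier → Vector Carrier n → Vector Carrier n
  a *ᵛ v = map (a *_) v

  combination : ∀ {m n} → Vector Carrier n → Vector (Vector Carrier m) n → Vector Carrier m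
  combination a b j = sum (λ i → a i * b i j)

  combination-cong : ∀ {m n} {a a′ : Vector Carrier n} (b : Vector (Vector Carrier m) n) →
    a ≋ a′ → combination a b ≋ combination a′ b
  combination-cong b a≋a′ j = sum-cong-≋ (λ i → *-congʳ (a≋a′ i))

  combination-+ : ∀ {m n} a a′ (b : Vector (Vector Carrier m) n) →
    combination (a +ᵛ a′) b ≋ combination a b +ᵛ combination a′ b
  combination-+ a a′ b j = trans (sum-cong-≋ (λ i → distribʳ (b i j) (a i) (a′ i)))
    (∑-distrib-+ (λ i → a i * b i j) _)

  combination-* : ∀ {m n} s a (b : Vector (Vector Carrier m) n) →
    combination (s *ᵛ a) b ≋ s *ᵛ combination a b
  combination-* s a b j = trans (sum-cong-≋ (λ i → *-assoc s (a i) (b i j)))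
    (sym (*-distribˡ-sum s (λ i → a i * b i j)))

  unit : ∀ {n} → Fin n → Vector Carrier n
  unit zero    = 1# ∷ 0ᵛ
  unit (suc i) = 0# ∷ unit i

  combination-0 : ∀ {m n} (b : Vector (Vector Carrier m) n) → combination 0ᵛ b ≋ 0ᵛ
  combination-0 b j = begin
    combination 0ᵛ b j          ≈⟨ combination-cong b (λ _ → sym (zeroˡ 0#)) j ⟩
    combination (0# *ᵛ 0ᵛ) b j  ≈⟨ combination-* 0# 0ᵛ b j ⟩
    0# * combination 0ᵛ b j     ≈⟨ zeroˡ _ ⟩
    0#                          ∎

  combination-unit : ∀ {m n} i (b : Vector (Vector Carrier m) n) → combination (unit i) b ≋ b i
  combination-unit zero    b j = begin
    1# * b zero j + combination 0ᵛ (b ∘ suc) j  ≈⟨ +-cong (*-identityˡ _) (combination-0 (b ∘ suc) j) ⟩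
    b zero j + 0#                               ≈⟨ +-identityʳ _ ⟩
    b zero j                                    ∎
  combination-unit (suc i) b j = begin
    0# * b zero j + combination (unit i) (b ∘ suc) j  ≈⟨ +-cong (zeroˡ _) (combination-unit i (b ∘ suc) j) ⟩
    0# + b (suc i) j                                  ≈⟨ +-identityˡ _ ⟩
    b (suc i) j                                       ∎

  abstract
    -- Pigeonhole in place of elimination: `q ^ n` coefficient vectors have at most `q ^ m` values,
    -- so two of them give the same combination, and their difference is the relation.
    linearlyDependent : ∀ {m n} → m ℕ.< n → (b : Vector (Vector Carrier m) n) →
      ∃[ a ] ¬ a ≋ 0ᵛ × combination a b ≋ 0ᵛ
    linearlyDependent {m} {n} m<n b =
      x +ᵛ - 1# *ᵛ y
      , (λ x-y≋0 → contradiction (≡.trans (≡.sym (strictlyInverseˡ k)) (≡.trans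
          (to-cong (λ i → x+-1*y≈0⇒x≈y (x-y≋0 i))) (strictlyInverseˡ l))) (Finₚ.<⇒≢ k<l))
      , λ j → begin
          combination (x +ᵛ - 1# *ᵛ y) b j
            ≈⟨ combination-+ x (- 1# *ᵛ y) b j ⟩
          combination x b j + combination (- 1# *ᵛ y) b j
            ≈⟨ +-cong (FiniteSetoid.to-injective (≋-setoid m) (vectorEnumeration setoid order m) image≡ j)
                      (combination-* (- 1#) y b j) ⟩
          combination y b j + - 1# * combination y b j
            ≈⟨ solve 1 (λ s → s :+ :- :1 :* s := :0) refl _ ⟩
          0# ∎
      where
      open Inverse (vectorEnumeration setoid order n)
      module Target = Inverse (vectorEnumeration setoid order m)

      image : Fin (q ℕ.^ n) → Fin (q ℕ.^ m)
      image k = Target.to (combination (from k) b)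

      collision : ∃₂ λ k l → k Fin.< l × image k ≡ image l
      collision = Finₚ.pigeonhole (ℕₚ.^-monoʳ-< q 1<q m<n) image
      k l : Fin (q ℕ.^ n)
      k = proj₁ collision
      l = proj₁ (proj₂ collision)
      k<l : k Fin.< l
      k<l = proj₁ (proj₂ (proj₂ collision))
      image≡ : image k ≡ image l
      image≡ = proj₂ (proj₂ (proj₂ collision))
      x y : Vector Carrier n
      x = from k
      y = from l

      x+-1*y≈0⇒x≈y : ∀ {x y} → x + - 1# * y ≈ 0# → x ≈ y
      x+-1*y≈0⇒x≈y {x} {y} eq = x-y≈0⇒x≈y (trans (solve 2 (λ x y → x :- y := x :+ :- :1 :* y) refl x y) eq)

  -- The opposite sign on the second plane matches the condition `normal` of a hyperbolic frame, and
  -- it makes the value on `v` and `J 1# v` equal to `Q v`.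
  form : Vector Carrier 4 → Vector Carrier 4 → Carrier
  form x y = (x 0F * y 1F - x 1F * y 0F) - (x 2F * y 3F - x 3F * y 2F)

  :form : ∀ {n} → Vector (Polynomial n) 4 → Vector (Polynomial n) 4 → Polynomial n
  :form x y = (x 0F :* y 1F :- x 1F :* y 0F) :- (x 2F :* y 3F :- x 3F :* y 2F)

  -- What the introduction of coordinates uses of a polarity, phrased for vectors instead of
  -- subspaces. The field `hyperplane` expresses that the polar of `x` has codimension at most one.
  record IsNullPolarity {n ℓ} (_⊥_ : Rel (Vector Carrier n) ℓ) : Set (c ⊔ ℓ₁ ⊔ ℓ) where
    field
      _⊥?_          : Decidable₂ _⊥_
      ⊥-resp        : ∀ {x} → (x ⊥_) Respects _≋_
      ⊥-sym         : Symmetric _⊥_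
      ⊥-refl        : Reflexive _⊥_
      ⊥-+           : ∀ {x y z} → x ⊥ y → x ⊥ z → x ⊥ (y +ᵛ z)
      ⊥-*           : ∀ {x} a {y} → x ⊥ y → x ⊥ (a *ᵛ y)
      nondegenerate : ∀ {x} → (∀ y → x ⊥ y) → x ≋ 0ᵛ
      hyperplane    : ∀ {x u} → ¬ x ⊥ u → ∀ v → ∃[ a ] x ⊥ (v +ᵛ a *ᵛ u)

  module _ (2∤q : 2 ∤ q) where

    -- If 2 = 0, translation by `1#` is an involution without fixed points on the `q` field
    -- elements.
    1+1≉0 : ¬ 1# + 1# ≈ 0#
    1+1≉0 2≈0 = 2∤q $ fixedPointFree-involution⇒even (to ∘ (1# +_) ∘ from)
      (λ i → inverseˡ (trans (+-congˡ (strictlyInverseʳ _))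
        (trans (sym (+-assoc _ _ _)) (trans (+-congʳ 2≈0) (+-identityˡ _)))))
      λ i fixed → 1≉0 $ begin
        1#                        ≈⟨ solve 1 (λ x → :1 := (:1 :+ x) :- x) refl (from i) ⟩
        (1# + from i) - from i    ≈⟨ +-congʳ (trans (sym (strictlyInverseʳ _)) (reflexive (≡.cong from fixed))) ⟩
        from i - from i           ≈⟨ -‿inverseʳ _ ⟩
        0#                        ∎
      where open Inverse order

    -- If squaring were surjective, a section together with the missed root of 1
    -- would embed Fin (suc q) into Fin q.
    abstract
      nonsquare : ∃[ ν ] ∀ x → ¬ x * x ≈ ν
      nonsquare = decidable-stable
        (search (λ ν≈μ h x x²≈μ → h x (trans x²≈μ (sym ν≈μ)))
          (λ ν → decide-∀ (λ x≈y h y²≈ν → h (trans (*-cong x≈y x≈y) y²≈ν)) (λ x → ¬? ((x * x) ≟ ν))))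
        λ none →
          let root : ∀ ν → ∃[ x ] x * x ≈ ν
              root ν = decidable-stable
                (search (λ x≈y → trans (*-cong (sym x≈y) (sym x≈y))) (λ x → (x * x) ≟ ν))
                (λ ¬root → none (ν , λ x x²≈ν → ¬root (x , x²≈ν)))
              r : Fin q → Carrier
              r i = proj₁ (root (from i))
              r² : ∀ i → r i * r i ≈ from i
              r² i = proj₂ (root (from i))
              r-injective : ∀ {i j} → r i ≈ r j → i ≡ j
              r-injective {i} {j} eq = ≡.trans (≡.sym (strictlyInverseˡ i)) (≡.trans
                (to-cong (trans (sym (r² i)) (trans (*-cong eq eq) (r² j)))) (strictlyInverseˡ j))
              s = r (to 1#)
              s²≈1 : s * s ≈ 1#
              s²≈1 = trans (r² (to 1#)) (strictlyInverseʳ 1#)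
              missed : ∀ i → ¬ r i ≈ - s
              missed i ri≈-s = 1≉0 $
                let from-i≈1 = begin
                      from i      ≈⟨ r² i ⟨
                      r i * r i   ≈⟨ *-cong ri≈-s ri≈-s ⟩
                      - s * - s   ≈⟨ solve 1 (λ s → :- s :* :- s := s :* s) refl s ⟩
                      s * s       ≈⟨ s²≈1 ⟩
                      1#          ∎
                    i≡to1 = ≡.trans (≡.sym (strictlyInverseˡ i)) (to-cong from-i≈1)
                    s≈0 = *-cancelˡ-0 1+1≉0 $ begin
                      (1# + 1#) * s  ≈⟨ solve 1 (λ s → (:1 :+ :1) :* s := s :- (:- s)) refl s ⟩
                      s - (- s)      ≈⟨ +-congˡ (-‿cong (trans (reflexive (≡.cong r (≡.sym i≡to1))) ri≈-s)) ⟨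
                      s - s          ≈⟨ -‿inverseʳ s ⟩
                      0#             ∎
                in trans (sym s²≈1) (trans (*-congˡ s≈0) (zeroʳ s))
              g : Fin (suc q) → Fin q
              g = λ { zero → to (- s) ; (suc i) → to (r i) }
              g-injective : ∀ {i j} → g i ≡ g j → i ≡ j
              g-injective = λ
                { {zero}  {zero}  _  → ≡.refl
                ; {zero}  {suc j} eq → contradiction (to-injective (≡.sym eq)) (missed j)
                ; {suc i} {zero}  eq → contradiction (to-injective eq) (missed i)
                ; {suc i} {suc j} eq → ≡.cong suc (r-injective (to-injective eq))
                }
          in ℕₚ.1+n≰n (Finₚ.injective⇒≤ {f = g} g-injective)
        where open Inverse order

-- The orthogonality relation of vectors induced by a symplectic polarity.

module Polarities {c ℓ₁ ℓ₂} (F : HeytingField c ℓ₁ ℓ₂) {q} (order : HasOrder F q) (d : ℕ) where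

  open FiniteField F order
  open PG F d
  open import Relation.Binary.Reasoning.Setoid setoid

  combination-closed : ∀ U {n} (a : Vector Carrier n) (b : Vector V n) →
    (∀ i → Member U (b i)) → Member U (combination a b)
  combination-closed U {zero}  a b b∈U = Subspace.0-closed U
  combination-closed U {suc n} a b b∈U = Subspace.+-closed U
    (Subspace.*-closed U (a zero) (b∈U zero)) (combination-closed U (a ∘ suc) (b ∘ suc) (b∈U ∘ suc))

  span : ∀ {n} → Vector V n → Subspace
  span b = record
    { Member   = λ v → ∃[ a ] v ≋ combination a b
    ; member?  = λ v → searchᵛ (λ a≋a′ v≋ → ≋-trans v≋ (combination-cong b a≋a′)) (λ a → v ≟ᵛ combination a b)
    ; resp     = λ v≋w (a , v≋) → a , ≋-trans (≋-sym v≋w) v≋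
    ; 0-closed = 0ᵛ , ≋-sym (combination-0 b)
    ; +-closed = λ (a , v≋) (a′ , w≋) → a +ᵛ a′ ,
        λ j → trans (+-cong (v≋ j) (w≋ j)) (sym (combination-+ a a′ b j))
    ; *-closed = λ s (a , v≋) → s *ᵛ a , λ j → trans (*-congˡ (v≋ j)) (sym (combination-* s a b j))
    }

  ∈-span : ∀ {n} (b : Vector V n) i → Member (span b) (b i)
  ∈-span b i = unit i , ≋-sym (combination-unit i b)

  span-least : ∀ U {n} {b : Vector V n} → (∀ i → Member U (b i)) → span b ⊆ U
  span-least U b∈U (a , v≋) = Subspace.resp U (≋-sym v≋) (combination-closed U a _ b∈U)

  ⟨_⟩ : V → Subspace
  ⟨ x ⟩ = span (x ∷ [])

  x∈⟨x⟩ : ∀ x → Member ⟨ x ⟩ x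
  x∈⟨x⟩ x = ∈-span (x ∷ []) zero

  ⟨⟩-least : ∀ U {x} → Member U x → ⟨ x ⟩ ⊆ U
  ⟨⟩-least U x∈U = span-least U {b = _ ∷ []} λ { zero → x∈U }

  point : ∀ x → ¬ x ≋ 0ᵛ → Point
  point x x≉0 = record
    { space = ⟨ x ⟩
    ; rank  = x ∷ [] , record
      { members     = ∈-span (x ∷ [])
      ; independent = λ { a ax≋0 zero → decidable-stable (a zero ≟ 0#) λ a≉0 → x≉0 λ j →
          *-cancelˡ-0 a≉0 (trans (sym (+-identityʳ _)) (ax≋0 j)) }
      ; spanning    = id
      }
    }

  point-generator : (x : Point) → ∃[ p ] ¬ p ≋ 0ᵛ × Point.space x ≐ ⟨ p ⟩
  point-generator x with b , isBasis ← Point.rank x =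
    b zero
    , (λ b≋0 → 1≉0 (IsBasis.independent isBasis (λ _ → 1#)
        (λ j → trans (+-identityʳ _) (trans (*-identityˡ _) (b≋0 j))) zero))
    , IsBasis.spanning isBasis
    , ⟨⟩-least (Point.space x) (IsBasis.members isBasis zero)

  full : Subspace
  full = record
    { Member = λ _ → Lift _ ⊤ ; member? = λ _ → yes _ ; resp = λ _ _ → _ ; 0-closed = _
    ; +-closed = λ _ _ → _ ; *-closed = λ _ _ → _ }

  null : Subspace
  null = span []

  null-least : ∀ U → null ⊆ U
  null-least U = span-least U {b = []} λ ()

  module _ (ζ : SymplecticPolarity) where

    open SymplecticPolarity ζ

    infix 4 _⊥_

    _⊥_ : V → V → Set (c ⊔ ℓ₁)
    x ⊥ y = Member (⟨ x ⟩ ^ζ) y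

    full^ζ⊆null : full ^ζ ⊆ null
    full^ζ⊆null = proj₁ (involutive null) ∘ antitone {null ^ζ} {full} _

    full⊆null^ζ : full ⊆ null ^ζ
    full⊆null^ζ = antitone {null} {full ^ζ} (null-least (full ^ζ)) ∘ proj₂ (involutive full)

    -- Being an antitone involution, `ζ` forms a Galois connection with itself. Symmetry of `⊥` is
    -- the case of two points.
    ⊆^ζ-swap : ∀ {U W} → U ⊆ W ^ζ → W ⊆ U ^ζ
    ⊆^ζ-swap {U} {W} U⊆W^ζ = antitone {U} {W ^ζ} U⊆W^ζ ∘ proj₂ (involutive W)

    ⊥-symmetric : ∀ {x y} → x ⊥ y → y ⊥ x
    ⊥-symmetric {x} {y} x⊥y = ⊆^ζ-swap {⟨ y ⟩} {⟨ x ⟩} (⟨⟩-least (⟨ x ⟩ ^ζ) x⊥y) (x∈⟨x⟩ x)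

    ⊥-reflexive : ∀ {x} → x ⊥ x
    ⊥-reflexive {x} with x ≟ᵛ 0ᵛ
    -- The zero vector spans no point, so `absolute` does not cover it.
    ... | yes x≋0 = Subspace.resp (⟨ x ⟩ ^ζ) (≋-sym x≋0) (Subspace.0-closed (⟨ x ⟩ ^ζ))
    ... | no x≉0  = absolute (point x x≉0) {x} (x∈⟨x⟩ x)

    ⊥-nondegenerate : ∀ {x} → (∀ y → x ⊥ y) → x ≋ 0ᵛ
    ⊥-nondegenerate {x} x⊥V = proj₂ (full^ζ⊆null (⊆^ζ-swap {full} {⟨ x ⟩} (λ {y} _ → x⊥V y) (x∈⟨x⟩ x)))

    -- ⟨ x ⟩ is an atom of the lattice of subspaces, so its image under ζ is a coatom.
    ⊥-hyperplane : ∀ {x u} → ¬ x ⊥ u → ∀ v → ∃[ a ] x ⊥ (v +ᵛ a *ᵛ u)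
    ⊥-hyperplane {x} {u} ¬x⊥u v = v∈U
      where
      P = ⟨ x ⟩ ^ζ

      -- `U` is the sum of `P` and the span of `u`, written so that membership of `v` is the wanted
      -- scalar. Its polar lies in ⟨x⟩ and misses `x`, hence is null, and so `U` is the whole space.
      U : Subspace
      U = record
        { Member   = λ v → ∃[ a ] Member P (v +ᵛ a *ᵛ u)
        ; member?  = λ v → search (λ a≈a′ → Subspace.resp P λ j → +-congˡ (*-congʳ a≈a′))
                                  (λ a → Subspace.member? P (v +ᵛ a *ᵛ u))
        ; resp     = λ v≋w (a , v+au∈P) → a , Subspace.resp P (λ j → +-congʳ (v≋w j)) v+au∈P
        ; 0-closed = 0# , Subspace.resp P
            (λ j → solve 1 (λ u → :0 := :0 :+ :0 :* u) refl (u j)) (Subspace.0-closed P)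
        ; +-closed = λ {v} {w} (a , v∈) (a′ , w∈) → a + a′ , Subspace.resp P
            (λ j → solve 5 (λ v w a a′ u → (v :+ a :* u) :+ (w :+ a′ :* u) := (v :+ w) :+ (a :+ a′) :* u)
                     refl (v j) (w j) a a′ (u j))
            (Subspace.+-closed P v∈ w∈)
        ; *-closed = λ s {v} (a , v∈) → s * a , Subspace.resp P
            (λ j → solve 4 (λ s v a u → s :* (v :+ a :* u) := s :* v :+ (s :* a) :* u) refl s (v j) a (u j))
            (Subspace.*-closed P s v∈)
        }

      P⊆U : P ⊆ U
      P⊆U {v} v∈P = 0# , Subspace.resp P
        (λ j → solve 2 (λ v u → v := v :+ :0 :* u) refl (v j) (u j)) v∈P

      u∈U : Member U u
      u∈U = - 1# , Subspace.resp P
        (λ j → solve 1 (λ u → :0 := u :+ :- :1 :* u) refl (u j)) (Subspace.0-closed P)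

      x∉U^ζ : ¬ Member (U ^ζ) x
      x∉U^ζ x∈U^ζ = ¬x⊥u (⊆^ζ-swap {⟨ x ⟩} {U} (⟨⟩-least (U ^ζ) x∈U^ζ) u∈U)

      U^ζ⊆⟨x⟩ : U ^ζ ⊆ ⟨ x ⟩
      U^ζ⊆⟨x⟩ = proj₁ (involutive ⟨ x ⟩) ∘ antitone {P} {U} P⊆U

      U^ζ⊆null : U ^ζ ⊆ null
      U^ζ⊆null {w} w∈U^ζ with a , w≋ax ← U^ζ⊆⟨x⟩ w∈U^ζ with a zero ≟ 0#
      ... | yes a≈0 = (λ ()) , λ j → begin
        w j                  ≈⟨ w≋ax j ⟩
        a zero * x j + 0#    ≈⟨ +-congʳ (*-congʳ a≈0) ⟩
        0# * x j + 0#        ≈⟨ solve 1 (λ x → :0 :* x :+ :0 := :0) refl (x j) ⟩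
        0#                   ∎
      ... | no a≉0 = contradiction (x∈U^ζ (reciprocal a≉0)) x∉U^ζ
        where
        x∈U^ζ : ∃[ r ] r * a zero ≈ 1# → Member (U ^ζ) x
        x∈U^ζ (r , ra≈1) = Subspace.resp (U ^ζ) (λ j → begin
          r * w j                    ≈⟨ *-congˡ (w≋ax j) ⟩
          r * (a zero * x j + 0#)    ≈⟨ solve 3 (λ r a x → r :* (a :* x :+ :0) := (r :* a) :* x) refl r (a zero) (x j) ⟩
          (r * a zero) * x j         ≈⟨ *-congʳ ra≈1 ⟩
          1# * x j                   ≈⟨ *-identityˡ _ ⟩
          x j                        ∎)
          (Subspace.*-closed (U ^ζ) r w∈U^ζ)

      v∈U : Member U v
      v∈U = proj₁ (involutive U) (antitone {U ^ζ} {null} U^ζ⊆null (full⊆null^ζ {v} _))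

    ⊥-isNullPolarity : IsNullPolarity _⊥_
    ⊥-isNullPolarity = record
      { _⊥?_          = λ x → Subspace.member? (⟨ x ⟩ ^ζ)
      ; ⊥-resp        = λ {x} → Subspace.resp (⟨ x ⟩ ^ζ)
      ; ⊥-sym         = λ {x} {y} → ⊥-symmetric {x} {y}
      ; ⊥-refl        = λ {x} → ⊥-reflexive {x}
      ; ⊥-+           = λ {x} → Subspace.+-closed (⟨ x ⟩ ^ζ)
      ; ⊥-*           = λ {x} → Subspace.*-closed (⟨ x ⟩ ^ζ)
      ; nondegenerate = λ {x} → ⊥-nondegenerate {x}
      ; hyperplane    = λ {x} {u} → ⊥-hyperplane {x} {u}
      }

-- Recovering the alternating form from a null polarity.

module HyperbolicFrames {c ℓ₁ ℓ₂} (F : HeytingField c ℓ₁ ℓ₂) {q} (order : HasOrder F q)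
  {ℓ} (_⊥_ : Rel (Vector (HeytingField.Carrier F) 4) ℓ)
  (isNullPolarity : FiniteField.IsNullPolarity F order _⊥_) where

  open FiniteField F order
  open IsNullPolarity isNullPolarity
  open import Relation.Binary.Reasoning.Setoid setoid

  private
    V = Vector Carrier 4

    variable
      x y z x′ y′ : V

  ⊥-combination : ∀ {n} (a : Vector Carrier n) {b : Vector V n} → (∀ i → x ⊥ b i) → x ⊥ combination a b
  ⊥-combination {x} {zero}  a x⊥b = ⊥-resp (λ j → zeroˡ (x j)) (⊥-* 0# ⊥-refl)
  ⊥-combination {n = suc _} a x⊥b = ⊥-+ (⊥-* (a zero) (x⊥b zero)) (⊥-combination (a ∘ suc) (x⊥b ∘ suc))

  ⊥-linear₂ : ∀ s t → x ⊥ y → x ⊥ z → s *ᵛ y +ᵛ t *ᵛ z ≋ y′ → x ⊥ y′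
  ⊥-linear₂ s t x⊥y x⊥z eq = ⊥-resp eq (⊥-+ (⊥-* s x⊥y) (⊥-* t x⊥z))

  ⊥-linear₃ : ∀ s t u → x ⊥ y → x ⊥ z → x ⊥ x′ → s *ᵛ y +ᵛ t *ᵛ z +ᵛ u *ᵛ x′ ≋ y′ → x ⊥ y′
  ⊥-linear₃ s t u x⊥y x⊥z x⊥x′ eq = ⊥-resp eq (⊥-+ (⊥-+ (⊥-* s x⊥y) (⊥-* t x⊥z)) (⊥-* u x⊥x′))

  ⊥-resp₂ : x ≋ y → z ≋ x′ → x ⊥ z → y ⊥ x′
  ⊥-resp₂ x≋y z≋x′ x⊥z = ⊥-sym (⊥-resp x≋y (⊥-sym (⊥-resp z≋x′ x⊥z)))

  ⊥-cancel : ∀ {a} → ¬ a ≈ 0# → x ⊥ (a *ᵛ y) → x ⊥ y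
  ⊥-cancel {y = y} {a = a} a≉0 x⊥ay with r , ra≈1 ← reciprocal a≉0 =
    ⊥-resp (λ j → trans (sym (*-assoc r a (y j))) (trans (*-congʳ ra≈1) (*-identityˡ (y j)))) (⊥-* r x⊥ay)

  abstract
    nonorthogonal : ¬ x ≋ 0ᵛ → ∃[ y ] ¬ x ⊥ y
    nonorthogonal {x} x≉0 = decidable-stable
      (searchᵛ (λ y≋z ¬x⊥y x⊥z → ¬x⊥y (⊥-resp (≋-sym y≋z) x⊥z)) (λ y → ¬? (x ⊥? y)))
      λ none → x≉0 (nondegenerate λ y → decidable-stable (x ⊥? y) λ ¬x⊥y → none (y , ¬x⊥y))

  -- The orthogonality conditions leave the scale of one plane against the other free; `normal`
  -- fixes it, with ratio -1 between the values of the form on the two pairs.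
  record IsHyperbolicFrame (e₁ f₁ e₂ f₂ : V) : Set ℓ where
    field
      e₁⊥e₂  : e₁ ⊥ e₂
      e₁⊥f₂  : e₁ ⊥ f₂
      f₁⊥e₂  : f₁ ⊥ e₂
      f₁⊥f₂  : f₁ ⊥ f₂
      ¬e₁⊥f₁ : ¬ e₁ ⊥ f₁
      ¬e₂⊥f₂ : ¬ e₂ ⊥ f₂
      normal : (e₁ +ᵛ e₂) ⊥ (f₁ +ᵛ f₂)

  -- This symmetry and `swap-12` move any frame vector into first place, so statements about the
  -- first coordinate transfer to the other three.
  swap-ef : ∀ {e₁ f₁ e₂ f₂} → IsHyperbolicFrame e₁ f₁ e₂ f₂ → IsHyperbolicFrame f₁ e₁ f₂ e₂
  swap-ef H = record
    { e₁⊥e₂ = f₁⊥f₂ ; e₁⊥f₂ = f₁⊥e₂ ; f₁⊥e₂ = e₁⊥f₂ ; f₁⊥f₂ = e₁⊥e₂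
    ; ¬e₁⊥f₁ = ¬e₁⊥f₁ ∘ ⊥-sym ; ¬e₂⊥f₂ = ¬e₂⊥f₂ ∘ ⊥-sym ; normal = ⊥-sym normal }
    where open IsHyperbolicFrame H

  swap-12 : ∀ {e₁ f₁ e₂ f₂} → IsHyperbolicFrame e₁ f₁ e₂ f₂ → IsHyperbolicFrame e₂ f₂ e₁ f₁
  swap-12 {e₁} {f₁} {e₂} {f₂} H = record
    { e₁⊥e₂ = ⊥-sym e₁⊥e₂ ; e₁⊥f₂ = ⊥-sym f₁⊥e₂ ; f₁⊥e₂ = ⊥-sym e₁⊥f₂ ; f₁⊥f₂ = ⊥-sym f₁⊥f₂
    ; ¬e₁⊥f₁ = ¬e₂⊥f₂ ; ¬e₂⊥f₂ = ¬e₁⊥f₁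
    ; normal = ⊥-resp₂ (λ j → +-comm (e₁ j) (e₂ j)) (λ j → +-comm (f₁ j) (f₂ j)) normal }
    where open IsHyperbolicFrame H

  frame : V → V → V → V → Vector V 4
  frame e₁ f₁ e₂ f₂ = e₁ ∷ f₁ ∷ e₂ ∷ f₂ ∷ []

  module FirstCoordinate {e₁ f₁ e₂ f₂} (H : IsHyperbolicFrame e₁ f₁ e₂ f₂) where

    open IsHyperbolicFrame H

    Φ : Vector Carrier 4 → V
    Φ x = combination x (frame e₁ f₁ e₂ f₂)

    -- The vector η = e₁ + t e₂ + u f₂ is orthogonal to f₂ + s f₁, to e₂ + r f₁, to e₁ and,
    -- the polarity being null, to itself; hence also to (t r + u s) f₁.
    cross : ∀ {t s u r} → (e₁ +ᵛ t *ᵛ e₂) ⊥ (f₂ +ᵛ s *ᵛ f₁) → (e₁ +ᵛ u *ᵛ f₂) ⊥ (e₂ +ᵛ r *ᵛ f₁) →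
      t * r + u * s ≈ 0#
    cross {t} {s} {u} {r} e₁+te₂⊥f₂+sf₁ e₁+uf₂⊥e₂+rf₁ = decidable-stable (k ≟ 0#) λ k≉0 →
      ¬e₁⊥f₁ $ ⊥-sym $ ⊥-linear₃ 1# (- t) (- u) (⊥-sym (⊥-cancel k≉0 η⊥kf₁)) f₁⊥e₂ f₁⊥f₂
        λ j → solve 5 (λ e₁ e₂ f₂ t u → :1 :* (e₁ :+ t :* e₂ :+ u :* f₂) :+ :- t :* e₂ :+ :- u :* f₂ := e₁)
          refl (e₁ j) (e₂ j) (f₂ j) t u
      where
      k = t * r + u * s
      η = e₁ +ᵛ t *ᵛ e₂ +ᵛ u *ᵛ f₂
      η⊥f₂+sf₁ : η ⊥ (f₂ +ᵛ s *ᵛ f₁)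
      η⊥f₂+sf₁ = ⊥-sym (⊥-+ (⊥-sym e₁+te₂⊥f₂+sf₁) (⊥-* u (⊥-sym (⊥-+ ⊥-refl (⊥-* s (⊥-sym f₁⊥f₂))))))
      η⊥e₂+rf₁ : η ⊥ (e₂ +ᵛ r *ᵛ f₁)
      η⊥e₂+rf₁ = ⊥-sym (⊥-linear₂ 1# t (⊥-sym e₁+uf₂⊥e₂+rf₁) (⊥-sym (⊥-+ ⊥-refl (⊥-* r (⊥-sym f₁⊥e₂))))
        λ j → solve 5 (λ e₁ e₂ f₂ t u → :1 :* (e₁ :+ u :* f₂) :+ t :* e₂ := e₁ :+ t :* e₂ :+ u :* f₂)
          refl (e₁ j) (e₂ j) (f₂ j) t u)
      η⊥e₁ : η ⊥ e₁
      η⊥e₁ = ⊥-sym (⊥-+ (⊥-+ ⊥-refl (⊥-* t e₁⊥e₂)) (⊥-* u e₁⊥f₂))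
      η⊥kf₁ : η ⊥ (k *ᵛ f₁)
      η⊥kf₁ = ⊥-linear₃ t u 1# η⊥e₂+rf₁ η⊥f₂+sf₁ (⊥-linear₂ 1# (- 1#) η⊥e₁ ⊥-refl λ _ → refl)
        λ j → solve 8 (λ e₁ f₁ e₂ f₂ t s u r →
            t :* (e₂ :+ r :* f₁) :+ u :* (f₂ :+ s :* f₁)
              :+ :1 :* (:1 :* e₁ :+ :- :1 :* (e₁ :+ t :* e₂ :+ u :* f₂))
            := (t :* r :+ u :* s) :* f₁)
          refl (e₁ j) (f₁ j) (e₂ j) (f₂ j) t s u r

    -- `hyperplane` provides some `r` in the place of `- u`; crossing it with `normal`, the case
    -- `t = s = 1`, gives r + u = 0.
    e₁+uf₂⊥e₂-uf₁ : ∀ u → (e₁ +ᵛ u *ᵛ f₂) ⊥ (e₂ +ᵛ - u *ᵛ f₁)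
    e₁+uf₂⊥e₂-uf₁ u = let r , e₁+uf₂⊥e₂+rf₁ = hyperplane ¬e₁+uf₂⊥f₁ e₂ in
      ⊥-resp (λ j → +-congˡ (*-congʳ (begin
        r                      ≈⟨ solve 2 (λ r u → r := (:1 :* r :+ u :* :1) :- u) refl r u ⟩
        (1# * r + u * 1#) - u  ≈⟨ +-congʳ (cross e₁+1e₂⊥f₂+1f₁ e₁+uf₂⊥e₂+rf₁) ⟩
        0# - u                 ≈⟨ +-identityˡ _ ⟩
        - u                    ∎))) e₁+uf₂⊥e₂+rf₁
      where
      ¬e₁+uf₂⊥f₁ : ¬ (e₁ +ᵛ u *ᵛ f₂) ⊥ f₁
      ¬e₁+uf₂⊥f₁ ⊥f₁ = ¬e₁⊥f₁ $ ⊥-sym $ ⊥-linear₂ 1# (- u) (⊥-sym ⊥f₁) f₁⊥f₂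
        λ j → solve 3 (λ e₁ f₂ u → :1 :* (e₁ :+ u :* f₂) :+ :- u :* f₂ := e₁) refl (e₁ j) (f₂ j) u
      e₁+1e₂⊥f₂+1f₁ : (e₁ +ᵛ 1# *ᵛ e₂) ⊥ (f₂ +ᵛ 1# *ᵛ f₁)
      e₁+1e₂⊥f₂+1f₁ = ⊥-resp₂ (λ j → +-congˡ (sym (*-identityˡ _)))
        (λ j → trans (+-comm _ _) (+-congˡ (sym (*-identityˡ _)))) normal

    -- The unknown is now `s`, crossed with the case `u = 1`, `r = −1` of the preceding lemma.
    e₁+te₂⊥f₂+tf₁ : ∀ t → (e₁ +ᵛ t *ᵛ e₂) ⊥ (f₂ +ᵛ t *ᵛ f₁)
    e₁+te₂⊥f₂+tf₁ t = let s , e₁+te₂⊥f₂+sf₁ = hyperplane ¬e₁+te₂⊥f₁ f₂ in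
      ⊥-resp (λ j → +-congˡ (*-congʳ (begin
        s                            ≈⟨ solve 2 (λ s t → s := (t :* (:- :1) :+ :1 :* s) :+ t) refl s t ⟩
        (t * (- 1#) + 1# * s) + t    ≈⟨ +-congʳ (cross e₁+te₂⊥f₂+sf₁ (e₁+uf₂⊥e₂-uf₁ 1#)) ⟩
        0# + t                       ≈⟨ +-identityˡ _ ⟩
        t                            ∎))) e₁+te₂⊥f₂+sf₁
      where
      ¬e₁+te₂⊥f₁ : ¬ (e₁ +ᵛ t *ᵛ e₂) ⊥ f₁
      ¬e₁+te₂⊥f₁ ⊥f₁ = ¬e₁⊥f₁ $ ⊥-sym $ ⊥-linear₂ 1# (- t) (⊥-sym ⊥f₁) f₁⊥e₂
        λ j → solve 3 (λ e₁ e₂ t → :1 :* (e₁ :+ t :* e₂) :+ :- t :* e₂ := e₁) refl (e₁ j) (e₂ j) t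

    -- For x = e₁ + b f₁ + c e₂ + d f₂ the three vectors p, g, h span the hyperplane form x y = 0.
    form≈0⇒⊥-monic : ∀ b c d y → y 1F ≈ b * y 0F + c * y 3F - d * y 2F → Φ (1# ∷ b ∷ c ∷ d ∷ []) ⊥ Φ y
    form≈0⇒⊥-monic b c d y y₁≈ = ⊥-linear₃ (y 0F) (y 3F) (y 2F) (⊥-sym p⊥ξ) (⊥-sym g⊥ξ) (⊥-sym h⊥ξ) λ j → begin
      y 0F * p j + y 3F * g j + y 2F * h j
        ≈⟨ solve 10 (λ b c d y₀ y₂ y₃ e₁ f₁ e₂ f₂ →
             y₀ :* (e₁ :+ b :* f₁) :+ y₃ :* (f₂ :+ c :* f₁) :+ y₂ :* (e₂ :+ :- d :* f₁)
             := y₀ :* e₁ :+ ((b :* y₀ :+ c :* y₃ :- d :* y₂) :* f₁ :+ (y₂ :* e₂ :+ (y₃ :* f₂ :+ :0))))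
             refl b c d (y 0F) (y 2F) (y 3F) (e₁ j) (f₁ j) (e₂ j) (f₂ j) ⟩
      y 0F * e₁ j + ((b * y 0F + c * y 3F - d * y 2F) * f₁ j + (y 2F * e₂ j + (y 3F * f₂ j + 0#)))
        ≈⟨ +-congˡ (+-congʳ (*-congʳ y₁≈)) ⟨
      Φ y j ∎
      where
      ξ = Φ (1# ∷ b ∷ c ∷ d ∷ [])
      p = e₁ +ᵛ b *ᵛ f₁
      g = f₂ +ᵛ c *ᵛ f₁
      h = e₂ +ᵛ - d *ᵛ f₁
      p⊥ξ : p ⊥ ξ
      p⊥ξ = ⊥-linear₃ 1# c d ⊥-refl (⊥-sym (⊥-+ (⊥-sym e₁⊥e₂) (⊥-* b (⊥-sym f₁⊥e₂))))
                                    (⊥-sym (⊥-+ (⊥-sym e₁⊥f₂) (⊥-* b (⊥-sym f₁⊥f₂))))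
        λ j → solve 7 (λ b c d e₁ f₁ e₂ f₂ → :1 :* (e₁ :+ b :* f₁) :+ c :* e₂ :+ d :* f₂
                        := :1 :* e₁ :+ (b :* f₁ :+ (c :* e₂ :+ (d :* f₂ :+ :0))))
          refl b c d (e₁ j) (f₁ j) (e₂ j) (f₂ j)
      g⊥ξ : g ⊥ ξ
      g⊥ξ = ⊥-linear₃ 1# b d (⊥-sym (e₁+te₂⊥f₂+tf₁ c)) (⊥-sym (⊥-+ f₁⊥f₂ (⊥-* c ⊥-refl)))
                             (⊥-sym (⊥-+ ⊥-refl (⊥-* c (⊥-sym f₁⊥f₂))))
        λ j → solve 7 (λ b c d e₁ f₁ e₂ f₂ → :1 :* (e₁ :+ c :* e₂) :+ b :* f₁ :+ d :* f₂
                        := :1 :* e₁ :+ (b :* f₁ :+ (c :* e₂ :+ (d :* f₂ :+ :0))))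
          refl b c d (e₁ j) (f₁ j) (e₂ j) (f₂ j)
      h⊥ξ : h ⊥ ξ
      h⊥ξ = ⊥-linear₃ 1# b c (⊥-sym (e₁+uf₂⊥e₂-uf₁ d)) (⊥-sym (⊥-+ f₁⊥e₂ (⊥-* (- d) ⊥-refl)))
                             (⊥-sym (⊥-+ ⊥-refl (⊥-* (- d) (⊥-sym f₁⊥e₂))))
        λ j → solve 7 (λ b c d e₁ f₁ e₂ f₂ → :1 :* (e₁ :+ d :* f₂) :+ b :* f₁ :+ c :* e₂
                        := :1 :* e₁ :+ (b :* f₁ :+ (c :* e₂ :+ (d :* f₂ :+ :0))))
          refl b c d (e₁ j) (f₁ j) (e₂ j) (f₂ j)

    form≈0⇒⊥ : ∀ x y → ¬ x 0F ≈ 0# → form x y ≈ 0# → Φ x ⊥ Φ y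
    form≈0⇒⊥ x y x₀≉0 form≈0 with r , rx₀≈1 ← reciprocal x₀≉0 =
      ⊥-sym $ ⊥-resp scaled $ ⊥-* (x 0F) $ ⊥-sym $
        form≈0⇒⊥-monic (r * x 1F) (r * x 2F) (r * x 3F) y y₁≈
      where
      y₁≈ : y 1F ≈ (r * x 1F) * y 0F + (r * x 2F) * y 3F - (r * x 3F) * y 2F
      y₁≈ = begin
        y 1F               ≈⟨ *-identityˡ _ ⟨
        1# * y 1F          ≈⟨ *-congʳ rx₀≈1 ⟨
        r * x 0F * y 1F
          ≈⟨ solve 9 (λ r x₀ x₁ x₂ x₃ y₀ y₁ y₂ y₃ →
               r :* x₀ :* y₁ := r :* :form (x₀ ∷ x₁ ∷ x₂ ∷ x₃ ∷ []) (y₀ ∷ y₁ ∷ y₂ ∷ y₃ ∷ [])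
                 :+ ((r :* x₁) :* y₀ :+ (r :* x₂) :* y₃ :- (r :* x₃) :* y₂))
               refl r (x 0F) (x 1F) (x 2F) (x 3F) (y 0F) (y 1F) (y 2F) (y 3F) ⟩
        r * form x y + _   ≈⟨ +-congʳ (trans (*-congˡ form≈0) (zeroʳ r)) ⟩
        0# + _             ≈⟨ +-identityˡ _ ⟩
        _                  ∎
      scaled : x 0F *ᵛ Φ (1# ∷ r * x 1F ∷ r * x 2F ∷ r * x 3F ∷ []) ≋ Φ x
      scaled j = begin
        x 0F * (1# * e₁ j + (r * x 1F * f₁ j + (r * x 2F * e₂ j + (r * x 3F * f₂ j + 0#))))
          ≈⟨ solve 9 (λ r x₀ x₁ x₂ x₃ e₁ f₁ e₂ f₂ →
               x₀ :* (:1 :* e₁ :+ (r :* x₁ :* f₁ :+ (r :* x₂ :* e₂ :+ (r :* x₃ :* f₂ :+ :0))))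
               := x₀ :* e₁ :+ (r :* x₀) :* (x₁ :* f₁ :+ (x₂ :* e₂ :+ (x₃ :* f₂ :+ :0))))
               refl r (x 0F) (x 1F) (x 2F) (x 3F) (e₁ j) (f₁ j) (e₂ j) (f₂ j) ⟩
        x 0F * e₁ j + (r * x 0F) * (x 1F * f₁ j + (x 2F * e₂ j + (x 3F * f₂ j + 0#)))
          ≈⟨ +-congˡ (trans (*-congʳ rx₀≈1) (*-identityˡ _)) ⟩
        Φ x j ∎

    -- Every term of `Φ x` except `x 0F *ᵛ e₁` is orthogonal to `f₁`, so orthogonality to `f₁` tests
    -- the coordinate along `e₁`.
    f₁⊥⇒x₀≈0 : ∀ x → f₁ ⊥ Φ x → x 0F ≈ 0#
    f₁⊥⇒x₀≈0 x f₁⊥Φx = decidable-stable (x 0F ≟ 0#) λ x₀≉0 → ¬e₁⊥f₁ $ ⊥-sym $ ⊥-cancel x₀≉0 $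
      ⊥-linear₂ 1# (- 1#) f₁⊥Φx
        (⊥-+ (⊥-* (x 1F) ⊥-refl) (⊥-+ (⊥-* (x 2F) f₁⊥e₂) (⊥-* (x 3F) f₁⊥f₂)))
        λ j → solve 8 (λ x₀ x₁ x₂ x₃ e₁ f₁ e₂ f₂ →
            :1 :* (x₀ :* e₁ :+ (x₁ :* f₁ :+ (x₂ :* e₂ :+ (x₃ :* f₂ :+ :0))))
              :+ :- :1 :* (x₁ :* f₁ :+ (x₂ :* e₂ :+ x₃ :* f₂)) := x₀ :* e₁)
          refl (x 0F) (x 1F) (x 2F) (x 3F) (e₁ j) (f₁ j) (e₂ j) (f₂ j)

  module Frame {e₁ f₁ e₂ f₂} (H : IsHyperbolicFrame e₁ f₁ e₂ f₂) where

    open FirstCoordinate H using (Φ; form≈0⇒⊥; f₁⊥⇒x₀≈0) public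

    private
      module EF = FirstCoordinate (swap-ef H)
      module S = FirstCoordinate (swap-12 H)
      module SEF = FirstCoordinate (swap-ef (swap-12 H))

      ef s : Vector Carrier 4 → Vector Carrier 4
      ef x = x 1F ∷ x 0F ∷ x 3F ∷ x 2F ∷ []
      s x = x 2F ∷ x 3F ∷ x 0F ∷ x 1F ∷ []

    Φ-ef : ∀ x → EF.Φ (ef x) ≋ Φ x
    Φ-ef x j = solve 4 (λ a b c d → b :+ (a :+ (d :+ (c :+ :0))) := a :+ (b :+ (c :+ (d :+ :0)))) 
      refl (x 0F * e₁ j) (x 1F * f₁ j) (x 2F * e₂ j) (x 3F * f₂ j)

    Φ-s : ∀ x → S.Φ (s x) ≋ Φ x
    Φ-s x j = solve 4 (λ a b c d → c :+ (d :+ (a :+ (b :+ :0))) := a :+ (b :+ (c :+ (d :+ :0)))) 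
      refl (x 0F * e₁ j) (x 1F * f₁ j) (x 2F * e₂ j) (x 3F * f₂ j)

    Φ-sef : ∀ x → SEF.Φ (ef (s x)) ≋ Φ x
    Φ-sef x j = solve 4 (λ a b c d → d :+ (c :+ (b :+ (a :+ :0))) := a :+ (b :+ (c :+ (d :+ :0)))) 
      refl (x 0F * e₁ j) (x 1F * f₁ j) (x 2F * e₂ j) (x 3F * f₂ j)

    form-ef : ∀ x y → form x y ≈ 0# → form (ef x) (ef y) ≈ 0#
    form-ef x y form≈0 = begin
      form (ef x) (ef y)
        ≈⟨ solve 8 (λ x₀ x₁ x₂ x₃ y₀ y₁ y₂ y₃ →
             :form (x₁ ∷ x₀ ∷ x₃ ∷ x₂ ∷ []) (y₁ ∷ y₀ ∷ y₃ ∷ y₂ ∷ [])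
             := :- :form (x₀ ∷ x₁ ∷ x₂ ∷ x₃ ∷ []) (y₀ ∷ y₁ ∷ y₂ ∷ y₃ ∷ []))
             refl (x 0F) (x 1F) (x 2F) (x 3F) (y 0F) (y 1F) (y 2F) (y 3F) ⟩
      - form x y  ≈⟨ trans (-‿cong form≈0) -0#≈0# ⟩
      0#          ∎

    form-s : ∀ x y → form x y ≈ 0# → form (s x) (s y) ≈ 0#
    form-s x y form≈0 = begin
      form (s x) (s y)
        ≈⟨ solve 2 (λ a b → b :- a := :- (a :- b)) refl (x 0F * y 1F - x 1F * y 0F) (x 2F * y 3F - x 3F * y 2F) ⟩
      - form x y  ≈⟨ trans (-‿cong form≈0) -0#≈0# ⟩
      0#          ∎

    Φ-0 : ∀ x → x ≋ 0ᵛ → Φ x ≋ 0ᵛ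
    Φ-0 x x≋0 = ≋-trans (combination-cong (frame e₁ f₁ e₂ f₂) x≋0) (combination-0 (frame e₁ f₁ e₂ f₂))

    -- A symmetry of the frame brings the first nonzero coordinate of `x` to the front; the form
    -- changes at most its sign, so its vanishing is kept.
    form≈0⇒Φ⊥Φ : ∀ x y → form x y ≈ 0# → Φ x ⊥ Φ y
    form≈0⇒Φ⊥Φ x y form≈0 with x 0F ≟ 0#
    ... | no x₀≉0 = form≈0⇒⊥ x y x₀≉0 form≈0
    ... | yes x₀≈0 with x 1F ≟ 0#
    ... | no x₁≉0 = ⊥-resp₂ (Φ-ef x) (Φ-ef y) (EF.form≈0⇒⊥ (ef x) (ef y) x₁≉0 (form-ef x y form≈0))
    ... | yes x₁≈0 with x 2F ≟ 0#
    ... | no x₂≉0 = ⊥-resp₂ (Φ-s x) (Φ-s y) (S.form≈0⇒⊥ (s x) (s y) x₂≉0 (form-s x y form≈0))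
    ... | yes x₂≈0 with x 3F ≟ 0#
    ... | no x₃≉0 = ⊥-resp₂ (Φ-sef x) (Φ-sef y)
      (SEF.form≈0⇒⊥ (ef (s x)) (ef (s y)) x₃≉0 (form-ef (s x) (s y) (form-s x y form≈0)))
    ... | yes x₃≈0 = ⊥-sym $ ⊥-resp
      (λ j → trans (zeroˡ _) (sym (Φ-0 x (λ { 0F → x₀≈0 ; 1F → x₁≈0 ; 2F → x₂≈0 ; 3F → x₃≈0 }) j)))
      (⊥-* 0# ⊥-refl)

    ⊥-frame⇒0 : ∀ x → (∀ i → frame e₁ f₁ e₂ f₂ i ⊥ Φ x) → x ≋ 0ᵛ
    ⊥-frame⇒0 x ⊥Φx 0F = f₁⊥⇒x₀≈0 x (⊥Φx 1F)
    ⊥-frame⇒0 x ⊥Φx 1F = EF.f₁⊥⇒x₀≈0 (ef x) (⊥-resp (≋-sym (Φ-ef x)) (⊥Φx 0F))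
    ⊥-frame⇒0 x ⊥Φx 2F = S.f₁⊥⇒x₀≈0 (s x) (⊥-resp (≋-sym (Φ-s x)) (⊥Φx 3F))
    ⊥-frame⇒0 x ⊥Φx 3F = SEF.f₁⊥⇒x₀≈0 (ef (s x)) (⊥-resp (≋-sym (Φ-sef x)) (⊥Φx 2F))

    -- The zero vector is orthogonal to the whole frame, and the frame tests all four coordinates.
    Φ-independent : ∀ x → Φ x ≋ 0ᵛ → x ≋ 0ᵛ
    Φ-independent x Φx≋0 = ⊥-frame⇒0 x λ i →
      ⊥-resp (λ j → trans (zeroˡ _) (sym (Φx≋0 j))) (⊥-* 0# ⊥-refl)

    abstract
      -- Five vectors in dimension four are dependent; independence of the frame keeps the
      -- coefficient of `v` away from zero, so the relation can be solved for `v`.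
      Φ-spanning : ∀ v → ∃[ x ] v ≋ Φ x
      Φ-spanning v = - r *ᵛ (a ∘ suc) , λ j → begin
          v j
            ≈⟨ *-identityˡ _ ⟨
          1# * v j
            ≈⟨ *-congʳ ra₀≈1 ⟨
          (r * a 0F) * v j
            ≈⟨ solve 4 (λ r a v φ → (r :* a) :* v := r :* (a :* v :+ φ) :+ :- r :* φ) refl r (a 0F) (v j) (Φ (a ∘ suc) j) ⟩
          r * (a 0F * v j + Φ (a ∘ suc) j) + - r * Φ (a ∘ suc) j
            ≈⟨ +-cong (trans (*-congˡ (relation j)) (zeroʳ r)) (sym (combination-* (- r) (a ∘ suc) (frame e₁ f₁ e₂ f₂) j)) ⟩
          0# + Φ (- r *ᵛ (a ∘ suc)) j
            ≈⟨ +-identityˡ _ ⟩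
          Φ (- r *ᵛ (a ∘ suc)) j ∎
        where
        dependence : ∃[ a ] ¬ a ≋ 0ᵛ × combination a (v ∷ frame e₁ f₁ e₂ f₂) ≋ 0ᵛ
        dependence = linearlyDependent (ℕₚ.n<1+n 4) (v ∷ frame e₁ f₁ e₂ f₂)
        a : Vector Carrier 5
        a = proj₁ dependence
        relation : combination a (v ∷ frame e₁ f₁ e₂ f₂) ≋ 0ᵛ
        relation = proj₂ (proj₂ dependence)

        a₀≉0 : ¬ a 0F ≈ 0#
        a₀≉0 a₀≈0 = proj₁ (proj₂ dependence) λ
          { zero    → a₀≈0
          ; (suc i) → Φ-independent (a ∘ suc) (λ j → begin
              Φ (a ∘ suc) j                ≈⟨ +-identityˡ _ ⟨
              0# + Φ (a ∘ suc) j           ≈⟨ +-congʳ (trans (*-congʳ a₀≈0) (zeroˡ _)) ⟨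
              a 0F * v j + Φ (a ∘ suc) j   ≈⟨ relation j ⟩
              0#                           ∎) i
          }

        r : Carrier
        r = proj₁ (reciprocal a₀≉0)
        ra₀≈1 : r * a 0F ≈ 1#
        ra₀≈1 = proj₂ (reciprocal a₀≉0)

    form-linear : ∀ t w x y → form (w +ᵛ - t *ᵛ x) y ≈ form w y - t * form x y
    form-linear t w x y = solve 13 (λ t w₀ w₁ w₂ w₃ x₀ x₁ x₂ x₃ y₀ y₁ y₂ y₃ →
        let w = w₀ ∷ w₁ ∷ w₂ ∷ w₃ ∷ [] ; x = x₀ ∷ x₁ ∷ x₂ ∷ x₃ ∷ [] ; y = y₀ ∷ y₁ ∷ y₂ ∷ y₃ ∷ [] in
        :form (λ i → w i :+ :- t :* x i) y := :form w y :- t :* :form x y)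
      refl t (w 0F) (w 1F) (w 2F) (w 3F) (x 0F) (x 1F) (x 2F) (x 3F) (y 0F) (y 1F) (y 2F) (y 3F)

    -- Otherwise `Φ y` is orthogonal to the hyperplane where `form w y` vanishes and also to `Φ x`
    -- outside of it, hence to everything. Then `y` is zero, and so is the form.
    Φ⊥Φ⇒form≈0 : ∀ x y → Φ x ⊥ Φ y → form x y ≈ 0#
    Φ⊥Φ⇒form≈0 x y Φx⊥Φy = decidable-stable (form x y ≟ 0#) absurd
      where
      Φy⊥V : ∃[ r ] r * form x y ≈ 1# → ∀ v → Φ y ⊥ v
      Φy⊥V (r , rk≈1) v = ⊥-linear₂ 1# t
        (⊥-sym (form≈0⇒Φ⊥Φ w′ y (begin
          form w′ y                               ≈⟨ form-linear t w x y ⟩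
          form w y - (r * form w y) * form x y
            ≈⟨ solve 3 (λ r k m → m :- r :* m :* k := m :- m :* (r :* k)) refl r (form x y) (form w y) ⟩
          form w y - form w y * (r * form x y)    ≈⟨ +-congˡ (-‿cong (*-congˡ rk≈1)) ⟩
          form w y - form w y * 1#                ≈⟨ solve 1 (λ m → m :- m :* :1 := :0) refl (form w y) ⟩
          0#                                      ∎)))
        (⊥-sym Φx⊥Φy)
        λ j → begin
          1# * Φ w′ j + t * Φ x j
            ≈⟨ +-congʳ (*-congˡ (combination-+ w (- t *ᵛ x) (frame e₁ f₁ e₂ f₂) j)) ⟩
          1# * (Φ w j + Φ (- t *ᵛ x) j) + t * Φ x j
            ≈⟨ +-congʳ (*-congˡ (+-congˡ (combination-* (- t) x (frame e₁ f₁ e₂ f₂) j))) ⟩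
          1# * (Φ w j + - t * Φ x j) + t * Φ x j
            ≈⟨ solve 3 (λ w t x → :1 :* (w :+ :- t :* x) :+ t :* x := w) refl (Φ w j) t (Φ x j) ⟩
          Φ w j
            ≈⟨ v≋Φw j ⟨
          v j ∎
        where
        w : Vector Carrier 4
        w = proj₁ (Φ-spanning v)
        v≋Φw : v ≋ Φ w
        v≋Φw = proj₂ (Φ-spanning v)
        -- The multiple of `x` whose removal from `w` makes `form w′ y` vanish, as `r` inverts
        -- `form x y`.
        t = r * form w y
        w′ = w +ᵛ - t *ᵛ x

      absurd : ¬ ¬ form x y ≈ 0#
      absurd form≉0 = form≉0 $
        let y≋0 = Φ-independent y (nondegenerate (Φy⊥V (reciprocal form≉0))) in begin
          form x y
            ≈⟨ +-cong (+-cong (*-congˡ (y≋0 1F)) (-‿cong (*-congˡ (y≋0 0F))))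
                      (-‿cong (+-cong (*-congˡ (y≋0 3F)) (-‿cong (*-congˡ (y≋0 2F))))) ⟩
          form x 0ᵛ
            ≈⟨ solve 4 (λ a b c d → (a :* :0 :- b :* :0) :- (c :* :0 :- d :* :0) := :0) refl (x 0F) (x 1F) (x 2F) (x 3F) ⟩
          0# ∎

  abstract
    -- A symplectic Gram-Schmidt step: a multiple of `f` corrects `v` against `e`, then a multiple
    -- of `e` corrects against `f` without spoiling the first, since `e ⊥ e`.
    project : ∀ {e f} → ¬ e ⊥ f → ∀ v →
      ∃[ a ] ∃[ b ] (e ⊥ (v +ᵛ a *ᵛ f +ᵛ b *ᵛ e)) × (f ⊥ (v +ᵛ a *ᵛ f +ᵛ b *ᵛ e))
    project ¬e⊥f v with a , e⊥v+af ← hyperplane ¬e⊥f v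
                   with b , f⊥v+af+be ← hyperplane (¬e⊥f ∘ ⊥-sym) _ =
      a , b , ⊥-+ e⊥v+af (⊥-* b ⊥-refl) , f⊥v+af+be

    -- The projections of three independent vectors to ⟨ e , f ⟩ satisfy a linear relation.
    orthogonalVector : ∀ {e f} → ¬ e ⊥ f → ∃[ v ] ¬ v ≋ 0ᵛ × e ⊥ v × f ⊥ v
    orthogonalVector {e} {f} ¬e⊥f = v
      , (λ v≋0 → a≉0 λ
          { 0F → trans (solve 3 (λ a b c → a := a :* :1 :+ (b :* :0 :+ (c :* :0 :+ :0))) refl (a 0F) (a 1F) (a 2F)) (v≋0 0F)
          ; 1F → trans (solve 3 (λ a b c → b := a :* :0 :+ (b :* :1 :+ (c :* :0 :+ :0))) refl (a 0F) (a 1F) (a 2F)) (v≋0 1F)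
          ; 2F → trans (solve 3 (λ a b c → c := a :* :0 :+ (b :* :0 :+ (c :* :1 :+ :0))) refl (a 0F) (a 1F) (a 2F)) (v≋0 2F) })
      , ⊥-resp w≋v (⊥-combination a λ i → proj₁ (proj₂ (proj₂ (projection i))))
      , ⊥-resp w≋v (⊥-combination a λ i → proj₂ (proj₂ (proj₂ (projection i))))
      where
      δ : Vector V 3
      δ i = unit (Fin.inject₁ i)

      projection : ∀ i → ∃[ a ] ∃[ b ] (e ⊥ (δ i +ᵛ a *ᵛ f +ᵛ b *ᵛ e)) × (f ⊥ (δ i +ᵛ a *ᵛ f +ᵛ b *ᵛ e))
      projection i = project ¬e⊥f (δ i)

      α β : Fin 3 → Carrier
      α i = proj₁ (projection i)
      β i = proj₁ (proj₂ (projection i))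

      dependence : ∃[ a ] ¬ a ≋ 0ᵛ × combination a (λ i → α i ∷ β i ∷ []) ≋ 0ᵛ
      dependence = linearlyDependent (ℕₚ.n<1+n 2) (λ i → α i ∷ β i ∷ [])
      a : Vector Carrier 3
      a = proj₁ dependence
      a≉0 : ¬ a ≋ 0ᵛ
      a≉0 = proj₁ (proj₂ dependence)
      relation : combination a (λ i → α i ∷ β i ∷ []) ≋ 0ᵛ
      relation = proj₂ (proj₂ dependence)
      v : V
      v = combination a δ

      w : Vector V 3
      w i = δ i +ᵛ α i *ᵛ f +ᵛ β i *ᵛ e

      -- By `relation` the multiples of `e` and `f` cancel, so the combination of the projected
      -- vectors is the same combination `v` of the unit vectors, which is nonzero.
      w≋v : combination a w ≋ v
      w≋v j = begin
        combination a w j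
          ≈⟨ solve 14 (λ a₀ a₁ a₂ α₀ α₁ α₂ β₀ β₁ β₂ δ₀ δ₁ δ₂ e f →
               a₀ :* (δ₀ :+ α₀ :* f :+ β₀ :* e) :+ (a₁ :* (δ₁ :+ α₁ :* f :+ β₁ :* e) :+ (a₂ :* (δ₂ :+ α₂ :* f :+ β₂ :* e) :+ :0))
               := (a₀ :* δ₀ :+ (a₁ :* δ₁ :+ (a₂ :* δ₂ :+ :0)))
                  :+ ((a₀ :* α₀ :+ (a₁ :* α₁ :+ (a₂ :* α₂ :+ :0))) :* f
                  :+ (a₀ :* β₀ :+ (a₁ :* β₁ :+ (a₂ :* β₂ :+ :0))) :* e))
               refl (a 0F) (a 1F) (a 2F) (α 0F) (α 1F) (α 2F) (β 0F) (β 1F) (β 2F) (δ 0F j) (δ 1F j) (δ 2F j) (e j) (f j) ⟩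
        v j + (combination a (λ i → α i ∷ β i ∷ []) 0F * f j + combination a (λ i → α i ∷ β i ∷ []) 1F * e j)
          ≈⟨ +-congˡ (+-cong (trans (*-congʳ (relation 0F)) (zeroˡ (f j))) (trans (*-congʳ (relation 1F)) (zeroˡ (e j)))) ⟩
        v j + (0# + 0#)
          ≈⟨ trans (+-congˡ (+-identityˡ 0#)) (+-identityʳ (v j)) ⟩
        v j ∎

    -- The scale `s` comes from `hyperplane` for `e₁ +ᵛ e₂`. It is nonzero: otherwise `e₁ +ᵛ e₂`
    -- would be orthogonal to `f₁`, and with `f₁ ⊥ e₂` also `e₁` would be.
    normalise : ∀ {e₁ f₁ e₂ f} → ¬ e₁ ⊥ f₁ → e₁ ⊥ e₂ → f₁ ⊥ e₂ → e₁ ⊥ f → f₁ ⊥ f → ¬ e₂ ⊥ f →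
      ∃[ s ] IsHyperbolicFrame e₁ f₁ e₂ (s *ᵛ f)
    normalise {e₁} {f₁} {e₂} {f} ¬e₁⊥f₁ e₁⊥e₂ f₁⊥e₂ e₁⊥f f₁⊥f ¬e₂⊥f = s , record
      { e₁⊥e₂  = e₁⊥e₂
      ; e₁⊥f₂  = ⊥-* s e₁⊥f
      ; f₁⊥e₂  = f₁⊥e₂
      ; f₁⊥f₂  = ⊥-* s f₁⊥f
      ; ¬e₁⊥f₁ = ¬e₁⊥f₁
      ; ¬e₂⊥f₂ = λ e₂⊥sf → ¬e₂⊥f (⊥-cancel s≉0 e₂⊥sf)
      ; normal = e₁+e₂⊥f₁+sf
      }
      where
      ¬e₁+e₂⊥f : ¬ (e₁ +ᵛ e₂) ⊥ f
      ¬e₁+e₂⊥f ⊥f = ¬e₂⊥f $ ⊥-sym $ ⊥-linear₂ 1# (- 1#) (⊥-sym ⊥f) (⊥-sym e₁⊥f) λ j →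
        solve 2 (λ e₁ e₂ → :1 :* (e₁ :+ e₂) :+ :- :1 :* e₁ := e₂) refl (e₁ j) (e₂ j)

      s : Carrier
      s = proj₁ (hyperplane ¬e₁+e₂⊥f f₁)

      e₁+e₂⊥f₁+sf : (e₁ +ᵛ e₂) ⊥ (f₁ +ᵛ s *ᵛ f)
      e₁+e₂⊥f₁+sf = proj₂ (hyperplane ¬e₁+e₂⊥f f₁)

      s≉0 : ¬ s ≈ 0#
      s≉0 s≈0 = ¬e₁⊥f₁ $ ⊥-sym $ ⊥-linear₂ 1# (- 1#)
        (⊥-sym (⊥-resp (λ j → trans (+-congˡ (trans (*-congʳ s≈0) (zeroˡ _))) (+-identityʳ (f₁ j))) e₁+e₂⊥f₁+sf))
        f₁⊥e₂
        λ j → solve 2 (λ e₁ e₂ → :1 :* (e₁ :+ e₂) :+ :- :1 :* e₂ := e₁) refl (e₁ j) (e₂ j)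

    hyperbolicFrame : ∃[ e₁ ] ∃[ f₁ ] ∃[ e₂ ] ∃[ f₂ ] IsHyperbolicFrame e₁ f₁ e₂ f₂
    hyperbolicFrame =
      let f₁ , ¬e₁⊥f₁                = nonorthogonal {unit 0F} (λ u≋0 → 1≉0 (u≋0 0F))
          e₂ , e₂≉0 , e₁⊥e₂ , f₁⊥e₂  = orthogonalVector ¬e₁⊥f₁
          v , ¬e₂⊥v                  = nonorthogonal e₂≉0
          a , b , e₁⊥f , f₁⊥f        = project ¬e₁⊥f₁ v
          -- Projecting `v` adds multiples of `f₁` and `e₁`, both orthogonal to `e₂`, so
          -- non-orthogonality to `e₂` survives.
          s , isFrame                = normalise ¬e₁⊥f₁ e₁⊥e₂ f₁⊥e₂ e₁⊥f f₁⊥f λ e₂⊥f → ¬e₂⊥v $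
            ⊥-linear₃ 1# (- a) (- b) e₂⊥f (⊥-sym f₁⊥e₂) (⊥-sym e₁⊥e₂) λ j →
              solve 5 (λ v a f b e → :1 :* (v :+ a :* f :+ b :* e) :+ :- a :* f :+ :- b :* e := v)
                refl (v j) a (f₁ j) b (unit 0F j)
      in _ , f₁ , e₂ , _ , isFrame

-- The spread in coordinates over K².

module Spreads {c ℓ₁ ℓ₂} (F : HeytingField c ℓ₁ ℓ₂) {q} (order : HasOrder F q) (2∤q : 2 ∤ q) where

  open FiniteField F order
  open import Relation.Binary.Reasoning.Setoid setoid

  private
    V = Vector Carrier 4

  ν : Carrier
  ν = proj₁ (nonsquare 2∤q)

  -- The norm of s + t√ν from K to F.
  norm : Carrier → Carrier → Carrier
  norm s t = s * s - ν * (t * t)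

  -- If `t` were nonzero, s/t would be a square root of `ν`.
  norm≈0⇒≈0 : ∀ s t → norm s t ≈ 0# → s ≈ 0# × t ≈ 0#
  norm≈0⇒≈0 s t norm≈0 = x*x≈0⇒x≈0 (begin
      s * s          ≈⟨ s²≈νt² ⟩
      ν * (t * t)    ≈⟨ *-congˡ (trans (*-congˡ t≈0) (zeroʳ t)) ⟩
      ν * 0#         ≈⟨ zeroʳ ν ⟩
      0#             ∎)
    , t≈0
    where
    s²≈νt² : s * s ≈ ν * (t * t)
    s²≈νt² = x-y≈0⇒x≈y norm≈0

    t≈0 : t ≈ 0#
    t≈0 = decidable-stable (t ≟ 0#) λ t≉0 →
      let r , rt≈1 = reciprocal t≉0 in proj₂ (nonsquare 2∤q) (r * s) (begin
        (r * s) * (r * s)            ≈⟨ solve 2 (λ r s → (r :* s) :* (r :* s) := (r :* r) :* (s :* s)) refl r s ⟩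
        (r * r) * (s * s)            ≈⟨ *-congˡ s²≈νt² ⟩
        (r * r) * (ν * (t * t))
          ≈⟨ solve 3 (λ r t ν → (r :* r) :* (ν :* (t :* t)) := (r :* t) :* (r :* t) :* ν) refl r t ν ⟩
        (r * t) * (r * t) * ν        ≈⟨ *-congʳ (*-cong rt≈1 rt≈1) ⟩
        1# * 1# * ν                  ≈⟨ trans (*-congʳ (*-identityˡ 1#)) (*-identityˡ ν) ⟩
        ν                            ∎)

  Q : V → Carrier
  Q v = norm (v 0F) (v 1F) - norm (v 2F) (v 3F)

  -- `σ = 1` is multiplication by √ν on (X, Y), `σ = −1` the one on (X̄, Y). The parameter lets both
  -- share the lemmas that use only σ² = 1.
  J : Carrier → V → V
  J σ v = σ * (ν * v 1F) ∷ σ * v 0F ∷ ν * v 3F ∷ v 2F ∷ []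

  -- `D` sends (X, Y) to (-X, Y), and `T` sends it to (Ȳ, X̄).
  D T : V → V
  D v = - v 0F ∷ - v 1F ∷ v 2F ∷ v 3F ∷ []
  T v = v 2F ∷ - v 3F ∷ v 0F ∷ - v 1F ∷ []

  infix 4 _∈[_]_

  _∈[_]_ : V → Carrier → V → Set (c ⊔ ℓ₁)
  w ∈[ σ ] v = ∃[ s ] ∃[ t ] w ≋ s *ᵛ v +ᵛ t *ᵛ J σ v

  private
    :norm : ∀ {n} → Polynomial n → Polynomial n → Polynomial n → Polynomial n
    :norm ν s t = s :* s :- ν :* (t :* t)

    :Q : ∀ {n} → Polynomial n → Vector (Polynomial n) 4 → Polynomial n
    :Q ν v = :norm ν (v 0F) (v 1F) :- :norm ν (v 2F) (v 3F)

    :J : ∀ {n} → Polynomial n → Polynomial n → Vector (Polynomial n) 4 → Vector (Polynomial n) 4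
    :J ν σ v = σ :* (ν :* v 1F) ∷ σ :* v 0F ∷ ν :* v 3F ∷ v 2F ∷ []

    :D :T : ∀ {n} → Vector (Polynomial n) 4 → Vector (Polynomial n) 4
    :D v = :- v 0F ∷ :- v 1F ∷ v 2F ∷ v 3F ∷ []
    :T v = v 2F ∷ :- v 3F ∷ v 0F ∷ :- v 1F ∷ []

    :span : ∀ {n} → Polynomial n → Polynomial n → (v w : Vector (Polynomial n) 4) → Vector (Polynomial n) 4
    :span s t v w j = s :* v j :+ t :* w j

    :-1 : ∀ {n} → Polynomial n
    :-1 = :- :1

  module ComplexStructure (σ : Carrier) (σ²≈1 : σ * σ ≈ 1#) where

    J-cong : ∀ {v w} → v ≋ w → J σ v ≋ J σ w
    J-cong v≋w 0F = *-congˡ (*-congˡ (v≋w 1F))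
    J-cong v≋w 1F = *-congˡ (v≋w 0F)
    J-cong v≋w 2F = *-congˡ (v≋w 3F)
    J-cong v≋w 3F = v≋w 2F

    private
      -- The solver treats `σ` as a free variable, so identities relying on σ² = 1 are proved with
      -- an explicit multiple of σ² - 1, which is dropped here.
      modulo-σ²-1 : ∀ {a b} r → a ≈ b + (σ * σ - 1#) * r → a ≈ b
      modulo-σ²-1 {a} {b} r a≈ = begin
        a                           ≈⟨ a≈ ⟩
        b + (σ * σ - 1#) * r        ≈⟨ +-congˡ (*-congʳ (+-congʳ σ²≈1)) ⟩
        b + (1# - 1#) * r           ≈⟨ solve 2 (λ b r → b :+ (:1 :- :1) :* r := b) refl b r ⟩
        b                           ∎

    J-span : ∀ s t v → J σ (s *ᵛ v +ᵛ t *ᵛ J σ v) ≋ s *ᵛ J σ v +ᵛ (ν * t) *ᵛ v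
    J-span s t v 0F = modulo-σ²-1 ((ν * t) * v 0F) (solve 6 (λ σ ν s t a b →
      σ :* (ν :* (s :* b :+ t :* (σ :* a))) := (s :* (σ :* (ν :* b)) :+ (ν :* t) :* a) :+ (σ :* σ :- :1) :* ((ν :* t) :* a))
      refl σ ν s t (v 0F) (v 1F))
    J-span s t v 1F = modulo-σ²-1 ((ν * t) * v 1F) (solve 6 (λ σ ν s t a b →
      σ :* (s :* a :+ t :* (σ :* (ν :* b))) := (s :* (σ :* a) :+ (ν :* t) :* b) :+ (σ :* σ :- :1) :* ((ν :* t) :* b))
      refl σ ν s t (v 0F) (v 1F))
    J-span s t v 2F = solve 5 (λ ν s t c d →
      ν :* (s :* d :+ t :* c) := s :* (ν :* d) :+ (ν :* t) :* c) refl ν s t (v 2F) (v 3F)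
    J-span s t v 3F = solve 5 (λ ν s t c d →
      s :* c :+ t :* (ν :* d) := s :* c :+ (ν :* t) :* d) refl ν s t (v 2F) (v 3F)

    Q-span : ∀ s t v → Q (s *ᵛ v +ᵛ t *ᵛ J σ v) ≈ norm s t * Q v
    Q-span s t v = modulo-σ²-1 (- ν * (t * t) * norm (v 0F) (v 1F)) (solve 8 (λ σ ν s t a b c d →
        let v = a ∷ b ∷ c ∷ d ∷ [] in
        :Q ν (:span s t v (:J ν σ v))
        := :norm ν s t :* :Q ν v :+ (σ :* σ :- :1) :* (:- ν :* (t :* t) :* :norm ν a b))
      refl σ ν s t (v 0F) (v 1F) (v 2F) (v 3F))

    -- Since J² = ν, the conjugate s - tJ satisfies (s - tJ)(s + tJ) = s² - νt².
    norm-reduces : ∀ s t v {w} → w ≋ s *ᵛ v +ᵛ t *ᵛ J σ v → norm s t *ᵛ v ≋ s *ᵛ w +ᵛ - t *ᵛ J σ w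
    norm-reduces s t v {w} w≋ j = begin
      norm s t * v j
        ≈⟨ solve 5 (λ ν s t v Jv → (s :* s :- ν :* (t :* t)) :* v
             := s :* (s :* v :+ t :* Jv) :+ :- t :* (s :* Jv :+ (ν :* t) :* v)) refl ν s t (v j) (J σ v j) ⟩
      s * (s * v j + t * J σ v j) + - t * (s * J σ v j + (ν * t) * v j)
        ≈⟨ +-cong (*-congˡ (sym (w≋ j))) (*-congˡ (sym (trans (J-cong w≋ j) (J-span s t v j)))) ⟩
      s * w j + - t * J σ w j ∎

    span-independent : ∀ {v} s t → ¬ v ≋ 0ᵛ → s *ᵛ v +ᵛ t *ᵛ J σ v ≋ 0ᵛ → s ≈ 0# × t ≈ 0#
    span-independent {v} s t v≉0 ≋0 = norm≈0⇒≈0 s t $ decidable-stable (norm s t ≟ 0#) λ norm≉0 →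
      v≉0 λ j → *-cancelˡ-0 norm≉0 (begin
        norm s t * v j              ≈⟨ norm-reduces s t v (≋-sym ≋0) j ⟩
        s * 0# + - t * J σ 0ᵛ j     ≈⟨ +-cong (zeroʳ s) (trans (*-congˡ (J0 j)) (zeroʳ (- t))) ⟩
        0# + 0#                     ≈⟨ +-identityˡ 0# ⟩
        0#                          ∎)
      where
      J0 : J σ 0ᵛ ≋ 0ᵛ
      J0 0F = trans (*-congˡ (zeroʳ ν)) (zeroʳ σ)
      J0 1F = zeroʳ σ
      J0 2F = zeroʳ ν
      J0 3F = refl

    span-nonzero : ∀ {v w} s t → w ≋ s *ᵛ v +ᵛ t *ᵛ J σ v → ¬ w ≋ 0ᵛ → ¬ norm s t ≈ 0#
    span-nonzero {v} {w} s t w≋ w≉0 norm≈0 = let s≈0 , t≈0 = norm≈0⇒≈0 s t norm≈0 in w≉0 λ j → begin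
      w j                       ≈⟨ w≋ j ⟩
      s * v j + t * J σ v j     ≈⟨ +-cong (trans (*-congʳ s≈0) (zeroˡ _)) (trans (*-congʳ t≈0) (zeroˡ _)) ⟩
      0# + 0#                   ≈⟨ +-identityˡ 0# ⟩
      0#                        ∎

    -- Division by s + tJ: apply the conjugate and divide by the norm, which is nonzero because `w`
    -- is.
    ∈[]-sym : ∀ {v w} → ¬ w ≋ 0ᵛ → w ∈[ σ ] v → v ∈[ σ ] w
    ∈[]-sym {v} {w} w≉0 (s , t , w≋) = let r , rn≈1 = reciprocal (span-nonzero s t w≋ w≉0) in
      r * s , - (r * t) , λ j → begin
        v j                                     ≈⟨ *-identityˡ (v j) ⟨
        1# * v j                                ≈⟨ *-congʳ rn≈1 ⟨
        (r * norm s t) * v j                    ≈⟨ *-assoc r (norm s t) (v j) ⟩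
        r * (norm s t * v j)                    ≈⟨ *-congˡ (norm-reduces s t v w≋ j) ⟩
        r * (s * w j + - t * J σ w j)
          ≈⟨ solve 5 (λ r s t w Jw → r :* (s :* w :+ :- t :* Jw) := (r :* s) :* w :+ :- (r :* t) :* Jw) refl r s t (w j) (J σ w j) ⟩
        (r * s) * w j + - (r * t) * J σ w j     ∎

    J-∈[] : ∀ {v w} → w ∈[ σ ] v → J σ w ∈[ σ ] v
    J-∈[] {v} (s , t , w≋) = ν * t , s , λ j →
      trans (J-cong w≋ j) (trans (J-span s t v j) (+-comm _ _))

    -- Consequently the choice of `J` by the vanishing of `Q` depends only on the line, not on the
    -- vector generating it.
    ∈[]⇒Q≈0⇔ : ∀ {v w} → ¬ w ≋ 0ᵛ → w ∈[ σ ] v → (Q w ≈ 0# → Q v ≈ 0#) × (Q v ≈ 0# → Q w ≈ 0#)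
    ∈[]⇒Q≈0⇔ {v} {w} w≉0 (s , t , w≋) =
      (λ Qw≈0 → *-cancelˡ-0 (span-nonzero s t w≋ w≉0) (trans (sym Qw≈) Qw≈0))
      , (λ Qv≈0 → trans Qw≈ (trans (*-congˡ Qv≈0) (zeroʳ _)))
      where
      norm-cong : ∀ {a b a′ b′} → a ≈ a′ → b ≈ b′ → norm a b ≈ norm a′ b′
      norm-cong a≈ b≈ = +-cong (*-cong a≈ a≈) (-‿cong (*-congˡ (*-cong b≈ b≈)))

      Qw≈ : Q w ≈ norm s t * Q v
      Qw≈ = trans (+-cong (norm-cong (w≋ 0F) (w≋ 1F)) (-‿cong (norm-cong (w≋ 2F) (w≋ 3F)))) (Q-span s t v)

    *∈[]⇒∈[] : ∀ {a v w} → ¬ a ≈ 0# → (a *ᵛ w) ∈[ σ ] v → w ∈[ σ ] v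
    *∈[]⇒∈[] {a} {v} {w} a≉0 (s , t , aw≋) with r , ra≈1 ← reciprocal a≉0 = r * s , r * t , λ j → begin
      w j                                   ≈⟨ *-identityˡ (w j) ⟨
      1# * w j                              ≈⟨ *-congʳ ra≈1 ⟨
      (r * a) * w j                         ≈⟨ *-assoc r a (w j) ⟩
      r * (a * w j)                         ≈⟨ *-congˡ (aw≋ j) ⟩
      r * (s * v j + t * J σ v j)
        ≈⟨ solve 5 (λ r s t v Jv → r :* (s :* v :+ t :* Jv) := (r :* s) :* v :+ (r :* t) :* Jv) refl r s t (v j) (J σ v j) ⟩
      (r * s) * v j + (r * t) * J σ v j     ∎

  Q-T : ∀ v → Q (T v) ≈ - Q v
  Q-T v = solve 5 (λ ν a b c d → let v = a ∷ b ∷ c ∷ d ∷ [] in :Q ν (:T v) := :- :Q ν v)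
    refl ν (v 0F) (v 1F) (v 2F) (v 3F)

  Q-D : ∀ v → Q (D v) ≈ Q v
  Q-D v = solve 5 (λ ν a b c d → let v = a ∷ b ∷ c ∷ d ∷ [] in :Q ν (:D v) := :Q ν v)
    refl ν (v 0F) (v 1F) (v 2F) (v 3F)

  form-J₊ : ∀ v → form v (J 1# v) ≈ Q v
  form-J₊ v = solve 5 (λ ν a b c d → let v = a ∷ b ∷ c ∷ d ∷ [] in :form v (:J ν :1 v) := :Q ν v)
    refl ν (v 0F) (v 1F) (v 2F) (v 3F)

  -- The counterpart of `Q` for the second map: up to sign, the value of the form on `v` and
  -- `J (- 1#) v`.
  Q₋ : V → Carrier
  Q₋ v = norm (v 0F) (v 1F) + norm (v 2F) (v 3F)

  form-J₋ : ∀ v → form v (J (- 1#) v) ≈ - Q₋ v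
  form-J₋ v = solve 5 (λ ν a b c d → let v = a ∷ b ∷ c ∷ d ∷ [] in
      :form v (:J ν :-1 v) := :- (:norm ν a b :+ :norm ν c d))
    refl ν (v 0F) (v 1F) (v 2F) (v 3F)

  -- On Q = 0 the two norms agree, so `Q₋ v` is twice a norm. Odd characteristic and the anisotropy
  -- of the norm then force `v` to be zero if it vanishes.
  Q≈0⇒Q₋≉0 : ∀ {v} → ¬ v ≋ 0ᵛ → Q v ≈ 0# → ¬ Q₋ v ≈ 0#
  Q≈0⇒Q₋≉0 {v} v≉0 Q≈0 Q₋≈0 = v≉0 λ
    { 0F → proj₁ (norm≈0⇒≈0 (v 0F) (v 1F) norm₁≈0) ; 1F → proj₂ (norm≈0⇒≈0 (v 0F) (v 1F) norm₁≈0)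
    ; 2F → proj₁ (norm≈0⇒≈0 (v 2F) (v 3F) norm₂≈0) ; 3F → proj₂ (norm≈0⇒≈0 (v 2F) (v 3F) norm₂≈0) }
    where
    norm₁≈norm₂ : norm (v 0F) (v 1F) ≈ norm (v 2F) (v 3F)
    norm₁≈norm₂ = x-y≈0⇒x≈y Q≈0

    norm₂≈0 : norm (v 2F) (v 3F) ≈ 0#
    norm₂≈0 = *-cancelˡ-0 (1+1≉0 2∤q) (begin
      (1# + 1#) * norm (v 2F) (v 3F)
        ≈⟨ solve 1 (λ n → (:1 :+ :1) :* n := n :+ n) refl (norm (v 2F) (v 3F)) ⟩
      norm (v 2F) (v 3F) + norm (v 2F) (v 3F)   ≈⟨ +-congʳ norm₁≈norm₂ ⟨
      Q₋ v                                      ≈⟨ Q₋≈0 ⟩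
      0#                                        ∎)

    norm₁≈0 : norm (v 0F) (v 1F) ≈ 0#
    norm₁≈0 = trans norm₁≈norm₂ norm₂≈0

  form-T : ∀ s t s′ t′ v → form (s *ᵛ v +ᵛ t *ᵛ J 1# v) (s′ *ᵛ T v +ᵛ t′ *ᵛ J 1# (T v)) ≈ 0#
  form-T s t s′ t′ v = solve 9 (λ ν s t s′ t′ a b c d → let v = a ∷ b ∷ c ∷ d ∷ [] in
      :form (:span s t v (:J ν :1 v)) (:span s′ t′ (:T v) (:J ν :1 (:T v))) := :0)
    refl ν s t s′ t′ (v 0F) (v 1F) (v 2F) (v 3F)

  -- In contrast to `form-T`, orthogonality fails by a multiple of `Q v`; hence `D` gives the polar
  -- line only on Q = 0.
  form-D : ∀ s t s′ t′ v →
    form (s *ᵛ v +ᵛ t *ᵛ J (- 1#) v) (s′ *ᵛ D v +ᵛ t′ *ᵛ J (- 1#) (D v)) ≈ (s * t′ - t * s′) * Q v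
  form-D s t s′ t′ v = solve 9 (λ ν s t s′ t′ a b c d → let v = a ∷ b ∷ c ∷ d ∷ [] in
      :form (:span s t v (:J ν :-1 v)) (:span s′ t′ (:D v) (:J ν :-1 (:D v))) := (s :* t′ :- t :* s′) :* :Q ν v)
    refl ν s t s′ t′ (v 0F) (v 1F) (v 2F) (v 3F)

  -- Expansion of w in the basis v, J v, T v, J (T v), with orthogonal planes ⟨ v , J v ⟩ and ⟨ T v , J (T v) ⟩.
  expand-T : ∀ v w j → Q v * w j ≈
    (form (J 1# (T v)) w * T v j + - form (T v) w * J 1# (T v) j)
      + (form v w * J 1# v j - form (J 1# v) w * v j)
  expand-T v w = λ
    { 0F → solve 9 (λ ν a b c d w x y z → identity 0F ν (a ∷ b ∷ c ∷ d ∷ []) (w ∷ x ∷ y ∷ z ∷ []))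
        refl ν (v 0F) (v 1F) (v 2F) (v 3F) (w 0F) (w 1F) (w 2F) (w 3F)
    ; 1F → solve 9 (λ ν a b c d w x y z → identity 1F ν (a ∷ b ∷ c ∷ d ∷ []) (w ∷ x ∷ y ∷ z ∷ []))
        refl ν (v 0F) (v 1F) (v 2F) (v 3F) (w 0F) (w 1F) (w 2F) (w 3F)
    ; 2F → solve 9 (λ ν a b c d w x y z → identity 2F ν (a ∷ b ∷ c ∷ d ∷ []) (w ∷ x ∷ y ∷ z ∷ []))
        refl ν (v 0F) (v 1F) (v 2F) (v 3F) (w 0F) (w 1F) (w 2F) (w 3F)
    ; 3F → solve 9 (λ ν a b c d w x y z → identity 3F ν (a ∷ b ∷ c ∷ d ∷ []) (w ∷ x ∷ y ∷ z ∷ []))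
        refl ν (v 0F) (v 1F) (v 2F) (v 3F) (w 0F) (w 1F) (w 2F) (w 3F)
    }
    where
    identity : ∀ {n} → Fin 4 → Polynomial n → (v w : Vector (Polynomial n) 4) → Polynomial n × Polynomial n
    identity j ν v w = :Q ν v :* w j :=
      (:form (J₊ (:T v)) w :* :T v j :+ :- :form (:T v) w :* J₊ (:T v) j)
        :+ (:form v w :* J₊ v j :- :form (J₊ v) w :* v j)
      where J₊ = :J ν :1

  -- The analogue of `expand-T` for the second map. The planes of `v` and `D v` are orthogonal only
  -- where `Q v` vanishes, and the last term corrects for this.
  expand-D : ∀ v w j → Q₋ v * w j ≈
    (form (J (- 1#) (D v)) w * D v j + - form (D v) w * J (- 1#) (D v) j)
      + ((form (J (- 1#) v) w * v j - form v w * J (- 1#) v j) + Q v * D w j)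
  expand-D v w = λ
    { 0F → solve 9 (λ ν a b c d w x y z → identity 0F ν (a ∷ b ∷ c ∷ d ∷ []) (w ∷ x ∷ y ∷ z ∷ []))
        refl ν (v 0F) (v 1F) (v 2F) (v 3F) (w 0F) (w 1F) (w 2F) (w 3F)
    ; 1F → solve 9 (λ ν a b c d w x y z → identity 1F ν (a ∷ b ∷ c ∷ d ∷ []) (w ∷ x ∷ y ∷ z ∷ []))
        refl ν (v 0F) (v 1F) (v 2F) (v 3F) (w 0F) (w 1F) (w 2F) (w 3F)
    ; 2F → solve 9 (λ ν a b c d w x y z → identity 2F ν (a ∷ b ∷ c ∷ d ∷ []) (w ∷ x ∷ y ∷ z ∷ []))
        refl ν (v 0F) (v 1F) (v 2F) (v 3F) (w 0F) (w 1F) (w 2F) (w 3F)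
    ; 3F → solve 9 (λ ν a b c d w x y z → identity 3F ν (a ∷ b ∷ c ∷ d ∷ []) (w ∷ x ∷ y ∷ z ∷ []))
        refl ν (v 0F) (v 1F) (v 2F) (v 3F) (w 0F) (w 1F) (w 2F) (w 3F)
    }
    where
    identity : ∀ {n} → Fin 4 → Polynomial n → (v w : Vector (Polynomial n) 4) → Polynomial n × Polynomial n
    identity j ν v w = (:norm ν (v 0F) (v 1F) :+ :norm ν (v 2F) (v 3F)) :* w j :=
      (:form (J₋ (:D v)) w :* :D v j :+ :- :form (:D v) w :* J₋ (:D v) j)
        :+ ((:form (J₋ v) w :* v j :- :form v w :* J₋ v j) :+ :Q ν v :* :D w j)
      where J₋ = :J ν :-1

  form≈0⇒∈T : ∀ {v w} → ¬ Q v ≈ 0# → form v w ≈ 0# → form (J 1# v) w ≈ 0# →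
    w ∈[ 1# ] T v
  form≈0⇒∈T {v} {w} Q≉0 vw≈0 Jvw≈0 = ComplexStructure.*∈[]⇒∈[] 1# (*-identityˡ 1#) Q≉0
    (form (J 1# (T v)) w , - form (T v) w , λ j → begin
      Q v * w j    ≈⟨ expand-T v w j ⟩
      _ + (form v w * J 1# v j - form (J 1# v) w * v j)
        ≈⟨ +-congˡ (+-cong (*-congʳ vw≈0) (-‿cong (*-congʳ Jvw≈0))) ⟩
      _ + (0# * J 1# v j - 0# * v j)
        ≈⟨ solve 3 (λ m a b → m :+ (:0 :* a :- :0 :* b) := m) refl _ (J 1# v j) (v j) ⟩
      form (J 1# (T v)) w * T v j + - form (T v) w * J 1# (T v) j ∎)

  -1*-1≈1 : - 1# * - 1# ≈ 1#
  -1*-1≈1 = solve 0 (:- :1 :* :- :1 := :1) refl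

  form≈0⇒∈D : ∀ {v w} → ¬ Q₋ v ≈ 0# → Q v ≈ 0# → form v w ≈ 0# → form (J (- 1#) v) w ≈ 0# →
    w ∈[ - 1# ] D v
  form≈0⇒∈D {v} {w} Q₋≉0 Q≈0 vw≈0 Jvw≈0 = ComplexStructure.*∈[]⇒∈[] (- 1#) -1*-1≈1 Q₋≉0
    (form (J (- 1#) (D v)) w , - form (D v) w , λ j → begin
      Q₋ v * w j    ≈⟨ expand-D v w j ⟩
      _ + ((form (J (- 1#) v) w * v j - form v w * J (- 1#) v j) + Q v * D w j)
        ≈⟨ +-congˡ (+-cong (+-cong (*-congʳ Jvw≈0) (-‿cong (*-congʳ vw≈0))) (*-congʳ Q≈0)) ⟩
      _ + ((0# * v j - 0# * J (- 1#) v j) + 0# * D w j)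
        ≈⟨ solve 4 (λ m a b c → m :+ ((:0 :* a :- :0 :* b) :+ :0 :* c) := m) refl _ (v j) (J (- 1#) v j) (D w j) ⟩
      form (J (- 1#) (D v)) w * D v j + - form (D v) w * J (- 1#) (D v) j ∎)

  form-cong : ∀ {x x′ y y′} → x ≋ x′ → y ≋ y′ → form x y ≈ form x′ y′
  form-cong x≋ y≋ = +-cong
    (+-cong (*-cong (x≋ 0F) (y≋ 1F)) (-‿cong (*-cong (x≋ 1F) (y≋ 0F))))
    (-‿cong (+-cong (*-cong (x≋ 2F) (y≋ 3F)) (-‿cong (*-cong (x≋ 3F) (y≋ 2F)))))

  -x≈0⇒x≈0 : ∀ {x} → - x ≈ 0# → x ≈ 0#
  -x≈0⇒x≈0 {x} -x≈0 = trans (sym (-‿involutive x)) (trans (-‿cong -x≈0) -0#≈0#)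

  -- The decision is a separate argument so that proofs can split on it; `σ[ v ]` and `partner v`
  -- later set it to `Q v ≟ 0#`.
  sign : ∀ {p} {P : Set p} → Dec P → Carrier
  sign (yes _) = - 1#
  sign (no _)  = 1#

  sign²≈1 : ∀ {p} {P : Set p} (d : Dec P) → sign d * sign d ≈ 1#
  sign²≈1 (yes _) = -1*-1≈1
  sign²≈1 (no _)  = *-identityˡ 1#

  sign-unique : ∀ {p p′} {P : Set p} {P′ : Set p′} (d : Dec P) (d′ : Dec P′) →
    (P → P′) → (P′ → P) → sign d ≡ sign d′
  sign-unique (yes _) (yes _)  f g = ≡.refl
  sign-unique (no _)  (no _)   f g = ≡.refl
  sign-unique (yes p) (no ¬p′) f g = contradiction (f p) ¬p′
  sign-unique (no ¬p) (yes p′) f g = contradiction (g p′) ¬p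

  partner-by : ∀ {p} {P : Set p} → Dec P → V → V
  partner-by (yes _) = D
  partner-by (no _)  = T

  module _ (v : V) where

    -- `D` preserves `Q` and `T` negates it, so the partner line is built with the same map `J`.
    sign-partner : (d : Dec (Q v ≈ 0#)) (d′ : Dec (Q (partner-by d v) ≈ 0#)) → sign d ≡ sign d′
    sign-partner d@(yes Q≈0) d′ = sign-unique d d′ (trans (Q-D v)) (λ _ → Q≈0)
    sign-partner d@(no Q≉0)  d′ = sign-unique d d′ (λ Q≈0 → contradiction Q≈0 Q≉0)
      (λ QT≈0 → -x≈0⇒x≈0 (trans (sym (Q-T v)) QT≈0))

    partner-nonzero : (d : Dec (Q v ≈ 0#)) → ¬ v ≋ 0ᵛ → ¬ partner-by d v ≋ 0ᵛ
    partner-nonzero (yes _) v≉0 D≋0 = v≉0 λ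
      { 0F → -x≈0⇒x≈0 (D≋0 0F) ; 1F → -x≈0⇒x≈0 (D≋0 1F) ; 2F → D≋0 2F ; 3F → D≋0 3F }
    partner-nonzero (no _)  v≉0 T≋0 = v≉0 λ
      { 0F → T≋0 2F ; 1F → -x≈0⇒x≈0 (T≋0 3F) ; 2F → T≋0 0F ; 3F → -x≈0⇒x≈0 (T≋0 1F) }

    form-partner : (d : Dec (Q v ≈ 0#)) → ∀ {w w′} →
      w ∈[ sign d ] v → w′ ∈[ sign d ] partner-by d v → form w w′ ≈ 0#
    form-partner (yes Q≈0) (s , t , w≋) (s′ , t′ , w′≋) = trans (form-cong w≋ w′≋)
      (trans (form-D s t s′ t′ v) (trans (*-congˡ Q≈0) (zeroʳ _)))
    form-partner (no _)    (s , t , w≋) (s′ , t′ , w′≋) = trans (form-cong w≋ w′≋) (form-T s t s′ t′ v)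

    form≈0⇒∈partner : (d : Dec (Q v ≈ 0#)) → ¬ v ≋ 0ᵛ → ∀ {w} →
      form v w ≈ 0# → form (J (sign d) v) w ≈ 0# → w ∈[ sign d ] partner-by d v
    form≈0⇒∈partner (yes Q≈0) v≉0 {w} = form≈0⇒∈D {v} {w} (Q≈0⇒Q₋≉0 {v} v≉0 Q≈0) Q≈0
    form≈0⇒∈partner (no Q≉0)  v≉0 {w} = form≈0⇒∈T {v} {w} Q≉0

    form-J≉0 : (d : Dec (Q v ≈ 0#)) → ¬ v ≋ 0ᵛ → ¬ form v (J (sign d) v) ≈ 0#
    form-J≉0 (yes Q≈0) v≉0 form≈0 = Q≈0⇒Q₋≉0 {v} v≉0 Q≈0 (-x≈0⇒x≈0 (trans (sym (form-J₋ v)) form≈0))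
    form-J≉0 (no Q≉0)  v≉0 form≈0 = Q≉0 (trans (sym (form-J₊ v)) form≈0)

  σ[_] : V → Carrier
  σ[ v ] = sign (Q v ≟ 0#)

  partner : V → V
  partner v = partner-by (Q v ≟ 0#) v

  infix 4 _∈ℓ_

  _∈ℓ_ : V → V → Set (c ⊔ ℓ₁)
  w ∈ℓ v = w ∈[ σ[ v ] ] v

  ∈ℓ-refl : ∀ v → v ∈ℓ v
  ∈ℓ-refl v = 1# , 0# , λ j → solve 2 (λ v Jv → v := :1 :* v :+ :0 :* Jv) refl (v j) (J σ[ v ] v j)

  module _ (v w : V) (w≉0 : ¬ w ≋ 0ᵛ) (w∈v : w ∈ℓ v) where

    private module C = ComplexStructure σ[ v ] (sign²≈1 (Q v ≟ 0#))

    σ-constant : σ[ w ] ≡ σ[ v ]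
    σ-constant = let to , from = C.∈[]⇒Q≈0⇔ {v} {w} w≉0 w∈v in sign-unique (Q w ≟ 0#) (Q v ≟ 0#) to from

    ∈ℓ-sym : v ∈ℓ w
    ∈ℓ-sym = ≡.subst (λ σ → v ∈[ σ ] w) (≡.sym σ-constant) (C.∈[]-sym {v} {w} w≉0 w∈v)

    J-∈ℓ : J σ[ w ] w ∈ℓ v
    J-∈ℓ = ≡.subst (λ σ → J σ w ∈ℓ v) (≡.sym σ-constant) (C.J-∈[] {v} {w} w∈v)

  σ-partner : ∀ v → σ[ v ] ≡ σ[ partner v ]
  σ-partner v = sign-partner v (Q v ≟ 0#) (Q (partner v) ≟ 0#)

-- Transport of the spread to the given polarity.

module SpecialSpread {c ℓ₁ ℓ₂} (F : HeytingField c ℓ₁ ℓ₂) {q} (order : HasOrder F q) (2∤q : 2 ∤ q)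
  (ζ : PG.SymplecticPolarity F 3) where

  open FiniteField F order
  open PG F 3
  open Polarities F order 3
  open Spreads F order 2∤q
  open HyperbolicFrames F order (_⊥_ ζ) (⊥-isNullPolarity ζ)
  open SymplecticPolarity ζ
  open import Relation.Binary.Reasoning.Setoid setoid

  module Construction {e₁ f₁ e₂ f₂} (H : IsHyperbolicFrame e₁ f₁ e₂ f₂) where

    open Frame H

    Φ-linear : ∀ s t v w → Φ (s *ᵛ v +ᵛ t *ᵛ w) ≋ s *ᵛ Φ v +ᵛ t *ᵛ Φ w
    Φ-linear s t v w j = trans (combination-+ (s *ᵛ v) (t *ᵛ w) (frame e₁ f₁ e₂ f₂) j)
      (+-cong (combination-* s v (frame e₁ f₁ e₂ f₂) j) (combination-* t w (frame e₁ f₁ e₂ f₂) j))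

    Φ-cong : ∀ {v w} → v ≋ w → Φ v ≋ Φ w
    Φ-cong = combination-cong (frame e₁ f₁ e₂ f₂)

    Φ-injective : ∀ {v w} → Φ v ≋ Φ w → v ≋ w
    Φ-injective {v} {w} Φv≋Φw j = x-y≈0⇒x≈y (begin
      v j - w j
        ≈⟨ solve 2 (λ v w → v :- w := :1 :* v :+ :- :1 :* w) refl (v j) (w j) ⟩
      1# * v j + - 1# * w j
        ≈⟨ Φ-independent (1# *ᵛ v +ᵛ - 1# *ᵛ w) (λ i → begin
             Φ (1# *ᵛ v +ᵛ - 1# *ᵛ w) i    ≈⟨ Φ-linear 1# (- 1#) v w i ⟩
             1# * Φ v i + - 1# * Φ w i     ≈⟨ +-congʳ (*-congˡ (Φv≋Φw i)) ⟩
             1# * Φ w i + - 1# * Φ w i     ≈⟨ solve 1 (λ a → :1 :* a :+ :- :1 :* a := :0) refl (Φ w i) ⟩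
             0#                            ∎) j ⟩
      0# ∎)

    Φ-nonzero : ∀ {v} → ¬ v ≋ 0ᵛ → ¬ Φ v ≋ 0ᵛ
    Φ-nonzero {v} v≉0 Φv≋0 = v≉0 (Φ-independent v Φv≋0)

    lineBasis : V → Vector V 2
    lineBasis v = Φ v ∷ Φ (J σ[ v ] v) ∷ []

    line : V → Subspace
    line v = span (lineBasis v)

    combination-lineBasis : ∀ v a →
      combination a (lineBasis v) ≋ Φ (a 0F *ᵛ v +ᵛ a 1F *ᵛ J σ[ v ] v)
    combination-lineBasis v a j = trans (+-congˡ (+-identityʳ _)) (sym (Φ-linear (a 0F) (a 1F) v (J σ[ v ] v) j))

    ∈ℓ⇒∈line : ∀ v {w} → w ∈ℓ v → Member (line v) (Φ w)
    ∈ℓ⇒∈line v (s , t , w≋) = (s ∷ t ∷ []) ,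
      ≋-trans (Φ-cong w≋) (≋-sym (combination-lineBasis v (s ∷ t ∷ [])))

    ∈line⇒∈ℓ : ∀ v {w} → Member (line v) (Φ w) → w ∈ℓ v
    ∈line⇒∈ℓ v (a , Φw≋) = a 0F , a 1F , Φ-injective (≋-trans Φw≋ (combination-lineBasis v a))

    line-⊆ : ∀ {v w} → ¬ w ≋ 0ᵛ → w ∈ℓ v → line w ⊆ line v
    line-⊆ {v} {w} w≉0 w∈v = span-least (line v) {b = lineBasis w} λ
      { 0F → ∈ℓ⇒∈line v w∈v ; 1F → ∈ℓ⇒∈line v (J-∈ℓ v w w≉0 w∈v) }

    -- This makes the lines a partition: a point common to two of them generates both.
    line-≐ : ∀ {v w} → ¬ v ≋ 0ᵛ → ¬ w ≋ 0ᵛ → w ∈ℓ v → line w ≐ line v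
    line-≐ {v} {w} v≉0 w≉0 w∈v = line-⊆ {v} {w} w≉0 w∈v , line-⊆ {w} {v} v≉0 (∈ℓ-sym v w w≉0 w∈v)

    spreadLine : ∀ v → ¬ v ≋ 0ᵛ → Line
    spreadLine v v≉0 = record
      { space = line v
      ; rank  = lineBasis v , record
        { members     = ∈-span (lineBasis v)
        ; independent = λ a ≋0 →
            let s≈0 , t≈0 = ComplexStructure.span-independent σ[ v ] (sign²≈1 (Q v ≟ 0#)) {v} (a 0F) (a 1F) v≉0
                  (Φ-independent (a 0F *ᵛ v +ᵛ a 1F *ᵛ J σ[ v ] v)
                    (≋-trans (≋-sym (combination-lineBasis v a)) ≋0))
            in λ { 0F → s≈0 ; 1F → t≈0 }
        ; spanning    = id
        }
      }

    S : Pred Line (c ⊔ ℓ₁)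
    S L = ∃[ v ] ¬ v ≋ 0ᵛ × Line.space L ≐ line v

    coordinates : ∀ (x : Point) → ∃[ v ] ¬ v ≋ 0ᵛ × Point.space x ≐ ⟨ Φ v ⟩
    coordinates x =
      let p , p≉0 , x≐p = point-generator x
          v , p≋Φv      = Φ-spanning p
      in v
       , (λ v≋0 → p≉0 (≋-trans p≋Φv (Φ-0 v v≋0)))
       , ≐-trans {j = Member ⟨ p ⟩} x≐p
           ( ⟨⟩-least ⟨ Φ v ⟩ {p} (Subspace.resp ⟨ Φ v ⟩ (≋-sym p≋Φv) (x∈⟨x⟩ (Φ v)))
           , ⟨⟩-least ⟨ p ⟩ {Φ v} (Subspace.resp ⟨ p ⟩ p≋Φv (x∈⟨x⟩ p)))

    orthogonal : ∀ x y {v w} → Point.space x ≐ ⟨ Φ v ⟩ → Point.space y ≐ ⟨ Φ w ⟩ →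
      form v w ≈ 0# → Orthogonal ζ x y
    orthogonal x y {v} {w} x≐v y≐w form≈0 u∈y =
      antitone {Point.space x} {⟨ Φ v ⟩} (proj₁ x≐v)
        (⟨⟩-least (⟨ Φ v ⟩ ^ζ) {Φ w} (form≈0⇒Φ⊥Φ v w form≈0) (proj₁ y≐w u∈y))

    on⇒∈ℓ : ∀ x L {v u} → Point.space x ≐ ⟨ Φ v ⟩ → Line.space L ≐ line u → x on L → v ∈ℓ u
    on⇒∈ℓ x L {v} {u} x≐v L≐u x-on-L = ∈line⇒∈ℓ u (proj₁ L≐u (x-on-L (proj₂ x≐v (x∈⟨x⟩ (Φ v)))))

    isSpread : IsSpread S
    isSpread = record
      { resp       = λ L≐M (v , v≉0 , L≐v) → v , v≉0 , ≐-trans (≐-sym L≐M) L≐v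
      ; partitions = λ x →
          let v , v≉0 , x≐v = coordinates x in
          spreadLine v v≉0
          , ((v , v≉0 , id , id)
            , λ u∈x → ⟨⟩-least (line v) {Φ v} (∈ℓ⇒∈line v (∈ℓ-refl v)) (proj₁ x≐v u∈x))
          -- A line of `S` through the point is `line u` for some `u` with `v ∈ℓ u`, hence equals
          -- `line v`.
          , λ {M} ((u , u≉0 , M≐u) , x-on-M) →
              ≐-trans (line-≐ {u} {v} u≉0 v≉0 (on⇒∈ℓ x M {v} {u} x≐v M≐u x-on-M)) (≐-sym M≐u)
      }

    -- A line inside its polar would have orthogonal basis vectors `Φ v` and `Φ (J σ[ v ] v)`,
    -- against `form-J≉0`.
    nonIsotropic : ∀ {L} → S L → ¬ TotallyIsotropic ζ L
    nonIsotropic {L} (v , v≉0 , L≐v) (_ , L⊆L^ζ) = form-J≉0 v (Q v ≟ 0#) v≉0 $ Φ⊥Φ⇒form≈0 v (J σ[ v ] v) $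
      antitone {⟨ Φ v ⟩} {Line.space L} (⟨⟩-least (Line.space L) (proj₂ L≐v (∈-span (lineBasis v) 0F)))
        (L⊆L^ζ (proj₂ L≐v (∈-span (lineBasis v) 1F)))

    OrthogonalLines⇒form≈0 : ∀ {L M v w} → ¬ v ≋ 0ᵛ → ¬ w ≋ 0ᵛ → OrthogonalLines ζ L M →
      Member (Line.space L) (Φ v) → Member (Line.space M) (Φ w) → form v w ≈ 0#
    OrthogonalLines⇒form≈0 {L} {M} {v} {w} v≉0 w≉0 L⊥M v∈L w∈M = Φ⊥Φ⇒form≈0 v w $
      L⊥M (point (Φ v) (Φ-nonzero {v} v≉0)) (point (Φ w) (Φ-nonzero {w} w≉0))
        (⟨⟩-least (Line.space L) v∈L) (⟨⟩-least (Line.space M) w∈M) (x∈⟨x⟩ (Φ w))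

    J-nonzero : ∀ {v} → ¬ v ≋ 0ᵛ → ¬ J σ[ v ] v ≋ 0ᵛ
    J-nonzero {v} v≉0 J≋0 = 1≉0 $ proj₂ $
      ComplexStructure.span-independent σ[ v ] (sign²≈1 (Q v ≟ 0#)) {v} 0# 1# v≉0 λ j → begin
        0# * v j + 1# * J σ[ v ] v j
          ≈⟨ solve 2 (λ v Jv → :0 :* v :+ :1 :* Jv := Jv) refl (v j) (J σ[ v ] v j) ⟩
        J σ[ v ] v j
          ≈⟨ J≋0 j ⟩
        0# ∎

    -- The line of `partner v` is the polar of `L`: `form-partner` shows that the two are
    -- orthogonal, and the expansions of a vector show that nothing outside it is orthogonal to `L`.
    uniquePartner : ∀ {L} → S L → ∃! _≐ᴸ_ λ M → S M × OrthogonalLines ζ L M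
    uniquePartner {L} (v , v≉0 , L≐v) =
      spreadLine (partner v) v*≉0
      , ((partner v , v*≉0 , id , id) , orthogonalLines)
      , λ {M} ((u , u≉0 , M≐u) , L⊥M) →
          let u∈M = proj₂ M≐u (∈-span (lineBasis u) 0F)
              -- Testing the generator `u` of `M` against the two basis vectors of `L` already
              -- places it on the partner line, and one nonzero vector determines a line of the
              -- spread.
              u∈v* = form≈0⇒∈partner v (Q v ≟ 0#) v≉0 {u}
                (OrthogonalLines⇒form≈0 {L} {M} {v} {u} v≉0 u≉0 L⊥M (proj₂ L≐v (∈-span (lineBasis v) 0F)) u∈M)
                (OrthogonalLines⇒form≈0 {L} {M} {J σ[ v ] v} {u} (J-nonzero {v} v≉0) u≉0 L⊥M (proj₂ L≐v (∈-span (lineBasis v) 1F)) u∈M)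
          in ≐-sym (≐-trans M≐u (line-≐ {partner v} {u} v*≉0 u≉0 (≡.subst (λ σ → u ∈[ σ ] partner v) (σ-partner v) u∈v*)))
      where
      v*≉0 : ¬ partner v ≋ 0ᵛ
      v*≉0 = partner-nonzero v (Q v ≟ 0#) v≉0

      orthogonalLines : OrthogonalLines ζ L (spreadLine (partner v) v*≉0)
      orthogonalLines x y x-on-L y-on-M =
        let w , _ , x≐w   = coordinates x
            w′ , _ , y≐w′ = coordinates y
        in orthogonal x y {w} {w′} x≐w y≐w′ $ form-partner v (Q v ≟ 0#)
             {w} {w′} (on⇒∈ℓ x L {w} {v} x≐w L≐v x-on-L)
             (≡.subst (λ σ → w′ ∈[ σ ] partner v) (≡.sym (σ-partner v))
               (on⇒∈ℓ y (spreadLine (partner v) v*≉0) {w′} {partner v} y≐w′ (id , id) y-on-M))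

    isSpecialSpread : IsSpecialSpread ζ S
    isSpecialSpread = record
      { isSpread     = isSpread
      ; nonIsotropic = λ {L} → nonIsotropic {L}
      ; partner      = λ {L} → uniquePartner {L}
      }

  specialSpread : ∃[ S ] IsSpecialSpread ζ S
  specialSpread = let e₁ , f₁ , e₂ , f₂ , H = hyperbolicFrame in
    Construction.S {e₁} {f₁} {e₂} {f₂} H , Construction.isSpecialSpread {e₁} {f₁} {e₂} {f₂} H

theorem3 : ∀ (q : ℕ) → IsPrimePower q → 2 ∤ q →
    ∀ {c ℓ₁ ℓ₂} (F : HeytingField c ℓ₁ ℓ₂) → HasOrder F q →
    (ζ : PG.SymplecticPolarity F 3) →
    ∃[ S ] PG.IsSpecialSpread F 3 ζ S
theorem3 q _ 2∤q F order ζ = SpecialSpread.specialSpread F order 2∤q ζ
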